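{- Let $\nu\in\{0,1\}$, $n\in\mathbb{N}$, $g_0,\dots,g_n\in\mathbb{R}$, and let $$f(x)=(1+x)^{\nu}\sum_{k=0}^n g_k x^k(1+x^2)^{n-k},\qquad g(x)=\sum_{k=0}^n g_k x^k .$$ Then $f(x)$ is Hurwitz stable if and only if $g(x)$ is Hurwitz stable. In particular, if $f(x)$ is Hurwitz stable and its leading coefficient is positive, then $f(x)$ is semi-$\gamma$-positive.
   Context: A polynomial $f\in\mathbb{C}[x]$ is Hurwitz stable if it is identically zero or $f(x)\ne0$ whenever $\Re(x)>0$. A polynomial written in the form $f(x)=(1+x)^{\nu}\sum_{k=0}^n g_k x^k(1+x^2)^{n-k}$ with $\nu\in\{0,1\}$ is called semi-$\gamma$-positive if $g_k\ge 0$ for all $0\le k\le n$. -}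

module Defs where

open import Algebra.Bundles using (CommutativeRing)
open import Algebra.Bundles.Raw using (RawRing)
open import Algebra.Definitions using (Invertible)
import Algebra.Definitions.RawSemiring as RawSemiringDefinitions
open import Data.Fin.Base using (Fin; toℕ)
open import Data.List.Base using (List; []; _∷_; map; foldr)
open import Data.Nat.Base as ℕ using (ℕ; zero; suc; _∸_)
open import Data.Product.Base using (_×_; _,_; ∃; ∃-syntax)
open import Data.Sum.Base using (_⊎_)
open import Data.Vec.Functional using (Vector)
open import Level using (Level; 0ℓ; _⊔_) renaming (suc to lsuc)
open import Relation.Binary.Core using (Rel)
import Relation.Binary.Construct.StrictToNonStrict as StrictToNonStrict
open import Relation.Binary.Structures using (IsStrictTotalOrder)
open import Relation.Nullary.Negation.Core using (¬_)
open import Relation.Unary using (Pred; Satisfiable)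

-- The real numbers, axiomatised as usual: a complete ordered field is unique
-- up to isomorphism.  The axioms are the classical ones: the order satisfies
-- decidable trichotomy, and every inhabited set that is bounded above has a
-- supremum s, where every y < s is exceeded by some member of the set.  Taken
-- together they entail excluded middle for Set (apply `complete` to
-- {0} ∪ {1 ∣ P} and compare the supremum with 0), so a statement about these
-- reals has its ordinary classical meaning.
record CompleteOrderedField : Set (lsuc 0ℓ) where
  infix 4 _<_
  field
    commutativeRing : CommutativeRing 0ℓ 0ℓ

  open CommutativeRing commutativeRing public

  field
    0≉1                : 0# ≉ 1#
    invertible         : ∀ x → x ≉ 0# → Invertible _≈_ 1# _*_ x
    _<_                : Rel Carrier 0ℓ
    isStrictTotalOrder : IsStrictTotalOrder _≈_ _<_
    +-monoˡ-<          : ∀ z {x y} → x < y → x + z < y + z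
    *-pos              : ∀ {x y} → 0# < x → 0# < y → 0# < x * y

  open StrictToNonStrict _≈_ _<_ public using (_≤_)

  UpperBound : Pred Carrier 0ℓ → Pred Carrier 0ℓ
  UpperBound S b = ∀ {x} → S x → x ≤ b

  IsSupremum : Pred Carrier 0ℓ → Pred Carrier 0ℓ
  IsSupremum S s = UpperBound S s × (∀ {y} → y < s → ∃[ x ] S x × y < x)

  field
    complete : (S : Pred Carrier 0ℓ) →
               Satisfiable S → Satisfiable (UpperBound S) → ∃ (IsSupremum S)

-- A polynomial is its list of coefficients, constant term first.  Trailing
-- zeros are allowed; _≋_ identifies lists that differ only by them.
module Polynomial {c ℓ : Level} (R : RawRing c ℓ) where
  open RawRing R

  Poly : Set c
  Poly = List Carrier

  coeff : Poly → ℕ → Carrier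
  coeff []      _       = 0#
  coeff (a ∷ p) zero    = a
  coeff (a ∷ p) (suc k) = coeff p k

  infix 4 _≋_
  _≋_ : Rel Poly ℓ
  p ≋ q = ∀ k → coeff p k ≈ coeff q k

  infixl 6 _⊞_
  _⊞_ : Poly → Poly → Poly
  []      ⊞ q       = q
  (a ∷ p) ⊞ []      = a ∷ p
  (a ∷ p) ⊞ (b ∷ q) = a + b ∷ p ⊞ q

  infixl 7 _⊠_
  _⊠_ : Poly → Poly → Poly
  []      ⊠ q = []
  (a ∷ p) ⊠ q = map (a *_) q ⊞ (0# ∷ p ⊠ q)

  const : Carrier → Poly
  const a = a ∷ []

  X : Poly
  X = 0# ∷ 1# ∷ []

  eval : Poly → Carrier → Carrier
  eval p x = foldr (λ a b → a + x * b) 0# p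

  IsLeadingCoefficient : Poly → Carrier → Set ℓ
  IsLeadingCoefficient p a =
    ∃[ d ] coeff p d ≈ a × a ≉ 0# × (∀ k → d ℕ.< k → coeff p k ≈ 0#)

  polyRawRing : RawRing c ℓ
  polyRawRing = record
    { Carrier = Poly
    ; _≈_     = _≋_
    ; _+_     = _⊞_
    ; _*_     = _⊠_
    ; -_      = map (-_)
    ; 0#      = []
    ; 1#      = const 1#
    }

module Complex (ℝ : CompleteOrderedField) where
  open CompleteOrderedField ℝ

  infix 5 _+i_
  record ℂ : Set where
    constructor _+i_
    field
      re : Carrier
      im : Carrier
  open ℂ public

  ℂ-rawRing : RawRing 0ℓ 0ℓ
  ℂ-rawRing = record
    { Carrier = ℂ
    ; _≈_     = λ z w → re z ≈ re w × im z ≈ im w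
    ; _+_     = λ z w → re z + re w +i im z + im w
    ; _*_     = λ z w → re z * re w - im z * im w +i re z * im w + im z * re w
    ; -_      = λ z → - re z +i - im z
    ; 0#      = 0# +i 0#
    ; 1#      = 1# +i 0#
    }

  fromReal : Carrier → ℂ
  fromReal a = a +i 0#

module Stability (ℝ : CompleteOrderedField) where
  open CompleteOrderedField ℝ using (Carrier; rawRing; 0#; _<_; _≤_)
  open Complex ℝ
  module ℂ[x] = Polynomial ℂ-rawRing
  module ℝ[x] = Polynomial rawRing

  HurwitzStable : ℂ[x].Poly → Set
  HurwitzStable f = f ℂ[x].≋ [] ⊎ (∀ z → 0# < re z → ¬ (ℂ[x].eval f z ≈ℂ 0ℂ))
    where open RawRing ℂ-rawRing using () renaming (_≈_ to _≈ℂ_; 0# to 0ℂ)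

  toℂ[x] : ℝ[x].Poly → ℂ[x].Poly
  toℂ[x] = map fromReal

  open ℝ[x] using (Poly; _≋_; const; X)
  open RawRing ℝ[x].polyRawRing using (_+_; _*_; 1#; rawSemiring)
  open RawSemiringDefinitions rawSemiring using (_^_; sum)

  ∑gₖxᵏ : (n : ℕ) → Vector Carrier (suc n) → Poly
  ∑gₖxᵏ n g = sum (λ k → const (g k) * X ^ toℕ k)

  -- ν : Fin 2 encodes ν ∈ {0,1}.  Since k ≤ n, truncated subtraction is exact.
  γ-form : Fin 2 → (n : ℕ) → Vector Carrier (suc n) → Poly
  γ-form ν n g =
    (1# + X) ^ toℕ ν *
    sum (λ k → const (g k) * X ^ toℕ k * (1# + X ^ 2) ^ (n ∸ toℕ k))

  -- Being semi-γ-positive is a property of a polynomial together with a given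
  -- way of writing it.
  record SemiγPositive (f : Poly) (ν : Fin 2) (n : ℕ)
                       (g : Vector Carrier (suc n)) : Set where
    field
      expansion   : f ≋ γ-form ν n g
      nonNegative : ∀ k → 0# ≤ g k

{-# OPTIONS --safe #-}
-- For Re x > 0 put z = x / (1 + x²), so that 1 / z = x + 1 / x.  Then Re z > 0, and
-- f(x) = (1 + x)^ν (1 + x²)ⁿ g(z) with a non-zero factor in front of g(z).  Conversely every z
-- with Re z > 0 arises in this way: the root x of z X² - X + z satisfies
-- |z|² (1 + |x|²) Re x = |x|² Re z.  Hence f and g vanish together on the half-plane.
--
-- If g has no zero in the open right half-plane, then it is up to a real constant a product of
-- factors X + α and X² + βX + γ with α, β, γ ≥ 0, so its coefficients all have the same sign.
-- They are not all ≤ 0 when the leading coefficient of f is positive.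
--
-- The factorisation needs the fundamental theorem of algebra, which is proved by d'Alembert's
-- argument: |p| attains its minimum, and the minimum can only be 0.
module Submission where

open import Defs
open import Algebra.Bundles using (CommutativeRing)
open import Algebra.Bundles.Raw using (RawRing)
import Algebra.Definitions.RawSemiring
import Algebra.Properties.CommutativeSemiring.Exp
import Algebra.Properties.Semiring.Sum
open import Algebra.Structures using (IsCommutativeRing)
open import Data.Empty using (⊥-elim)
open import Data.Fin.Base as Fin using (Fin; toℕ)
import Data.Fin.Properties as Fin
open import Data.List.Base using ([]; _∷_; length; map; tabulate)
open import Data.Nat.Base as ℕ using (ℕ; zero; suc; _∸_)
open import Data.Nat.Induction using (<-rec)
import Data.Nat.Properties as ℕ
open import Data.Product.Base using (_×_; _,_; proj₁; proj₂; ∃-syntax)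
open import Data.Sum.Base using (_⊎_; inj₁; inj₂; [_,_]′)
open import Data.Unit.Base using (⊤; tt)
open import Data.Vec.Functional using (Vector; tail)
open import Function.Base using (id)
open import Function.Bundles using (_⇔_; mk⇔)
open import Level using (Level; 0ℓ)
open import Relation.Binary.Bundles using (StrictTotalOrder; DecTotalOrder)
open import Relation.Binary.Definitions using (tri<; tri≈; tri>)
import Relation.Binary.Properties.StrictTotalOrder
open import Relation.Binary.PropositionalEquality as ≡ using (_≡_; cong)
open import Relation.Binary.Structures using (IsStrictTotalOrder)
open import Relation.Nullary using (¬_; Dec; yes; no; contradiction)
open import Relation.Nullary.Decidable using (decidable-stable)

-- Three obstacles shape the argument. Coefficient lists may end in zeros, so length is not degree;
-- whether a list is zero is decided by excluded middle, which completeness supplies. Compactness,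
-- needed for the minimum of |p|, is obtained without sequences: suprema of the two coordinates
-- locate the minimiser, and lower semicontinuity finishes. Moduli enter estimates only as squares,
-- and smallness is always an explicit ε. The zero polynomial counts as stable, while the
-- substitution between x and z relates values and not coefficients. Stability is therefore recast
-- as a dichotomy on the half-plane, zero everywhere or zero nowhere, and the first alternative is
-- turned back into zero coefficients by the growth of non-zero polynomials. The real factorisation
-- is never assembled: each division step passes the common sign from the quotient to the dividend,
-- because the divisor has non-negative coefficients.

module IntegerCoefficients {c ℓ : Level} (R : CommutativeRing c ℓ) where
  open CommutativeRing R
  open import Algebra.Properties.Ring ring using (-‿distribˡ-*; -‿distribʳ-*; -0#≈0#; -‿involutive)
  open import Algebra.Properties.AbelianGroup +-abelianGroup using (⁻¹-∙-comm)
  open import Algebra.Properties.CommutativeSemigroup +-commutativeSemigroup using (interchange)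
  open import Algebra.Properties.Semiring.Mult.TCOptimised semiring renaming (_×_ to infixl 8 _×′_)
  open import Algebra.Solver.Ring.AlmostCommutativeRing
  open import Data.Integer.Base as ℤ using (ℤ; +_; -[1+_]; _⊖_; _◃_)
  open import Data.Integer.Properties as ℤ using ([1+m]⊖[1+n]≡m⊖n)
  open import Data.Maybe.Base using (Maybe; just; nothing)
  open import Data.Sign.Base as Sign using (Sign)
  open import Relation.Binary.Reasoning.Setoid setoid

  -- The solver compares coefficients by a decision procedure, which a general ring does not have;
  -- integers serve as its numerals, for the reals and for `ℂ` alike. With this form of multiple the
  -- numerals 0 and 1 compute to `0#` and `1#`.
  fromℤ : ℤ → Carrier
  fromℤ (+ n)    = n ×′ 1#
  fromℤ -[1+ n ] = - (suc n ×′ 1#)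

  fromℤ-⊖ : ∀ m n → fromℤ (m ⊖ n) ≈ m ×′ 1# - n ×′ 1#
  fromℤ-⊖ zero    zero    = sym (-‿inverseʳ 0#)
  fromℤ-⊖ zero    (suc n) = sym (+-identityˡ _)
  fromℤ-⊖ (suc m) zero    = sym (trans (+-congˡ -0#≈0#) (+-identityʳ _))
  fromℤ-⊖ (suc m) (suc n) = begin
    fromℤ (suc m ⊖ suc n)                ≡⟨ ≡.cong fromℤ ([1+m]⊖[1+n]≡m⊖n m n) ⟩
    fromℤ (m ⊖ n)                        ≈⟨ fromℤ-⊖ m n ⟩
    m ×′ 1# - n ×′ 1#                      ≈⟨ +-identityˡ _ ⟨
    0# + (m ×′ 1# - n ×′ 1#)               ≈⟨ +-congʳ (-‿inverseʳ 1#) ⟨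
    (1# - 1#) + (m ×′ 1# - n ×′ 1#)        ≈⟨ interchange _ _ _ _ ⟩
    (1# + m ×′ 1#) + (- 1# - n ×′ 1#)      ≈⟨ +-cong (sym (1+× m 1#)) (⁻¹-∙-comm _ _) ⟩
    suc m ×′ 1# - (1# + n ×′ 1#)           ≈⟨ +-congˡ (-‿cong (1+× n 1#)) ⟨
    suc m ×′ 1# - suc n ×′ 1#              ∎

  fromℤ-+ : ∀ i j → fromℤ (i ℤ.+ j) ≈ fromℤ i + fromℤ j
  fromℤ-+ (+ m)    (+ n)    = ×-homo-+ 1# m n
  fromℤ-+ (+ m)    -[1+ n ] = fromℤ-⊖ m (suc n)
  fromℤ-+ -[1+ m ] (+ n)    = trans (fromℤ-⊖ n (suc m)) (+-comm _ _)
  fromℤ-+ -[1+ m ] -[1+ n ] = begin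
    - (suc (suc (m ℕ.+ n)) ×′ 1#)     ≡⟨ ≡.cong (λ k → - (suc k ×′ 1#)) (ℕ.+-suc m n) ⟨
    - ((suc m ℕ.+ suc n) ×′ 1#)       ≈⟨ -‿cong (×-homo-+ 1# (suc m) (suc n)) ⟩
    - (suc m ×′ 1# + suc n ×′ 1#)      ≈⟨ ⁻¹-∙-comm _ _ ⟨
    - (suc m ×′ 1#) - suc n ×′ 1#      ∎

  fromℤ-+◃ : ∀ n → fromℤ (Sign.+ ◃ n) ≈ n ×′ 1#
  fromℤ-+◃ zero    = refl
  fromℤ-+◃ (suc n) = refl

  fromℤ--◃ : ∀ n → fromℤ (Sign.- ◃ n) ≈ - (n ×′ 1#)
  fromℤ--◃ zero    = sym -0#≈0#
  fromℤ--◃ (suc n) = refl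

  fromℤ-* : ∀ i j → fromℤ (i ℤ.* j) ≈ fromℤ i * fromℤ j
  fromℤ-* (+ m)    (+ n)    = trans (fromℤ-+◃ (m ℕ.* n)) (×1-homo-* m n)
  fromℤ-* (+ m)    -[1+ n ] = begin
    fromℤ (Sign.- ◃ m ℕ.* suc n)     ≈⟨ fromℤ--◃ (m ℕ.* suc n) ⟩
    - ((m ℕ.* suc n) ×′ 1#)           ≈⟨ -‿cong (×1-homo-* m (suc n)) ⟩
    - (m ×′ 1# * suc n ×′ 1#)          ≈⟨ -‿distribʳ-* _ _ ⟩
    m ×′ 1# * - (suc n ×′ 1#)          ∎
  fromℤ-* -[1+ m ] (+ n)    = begin
    fromℤ (Sign.- ◃ suc m ℕ.* n)     ≈⟨ fromℤ--◃ (suc m ℕ.* n) ⟩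
    - ((suc m ℕ.* n) ×′ 1#)           ≈⟨ -‿cong (×1-homo-* (suc m) n) ⟩
    - (suc m ×′ 1# * n ×′ 1#)          ≈⟨ -‿distribˡ-* _ _ ⟩
    - (suc m ×′ 1#) * n ×′ 1#          ∎
  fromℤ-* -[1+ m ] -[1+ n ] = begin
    fromℤ (Sign.+ ◃ suc m ℕ.* suc n) ≈⟨ fromℤ-+◃ (suc m ℕ.* suc n) ⟩
    (suc m ℕ.* suc n) ×′ 1#           ≈⟨ ×1-homo-* (suc m) (suc n) ⟩
    suc m ×′ 1# * suc n ×′ 1#          ≈⟨ -‿involutive _ ⟨
    - - (suc m ×′ 1# * suc n ×′ 1#)    ≈⟨ -‿cong (-‿distribˡ-* _ _) ⟩
    - (- (suc m ×′ 1#) * suc n ×′ 1#)  ≈⟨ -‿distribʳ-* _ _ ⟩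
    - (suc m ×′ 1#) * - (suc n ×′ 1#)  ∎

  fromℤ-neg : ∀ i → fromℤ (ℤ.- i) ≈ - fromℤ i
  fromℤ-neg (+ zero)  = sym -0#≈0#
  fromℤ-neg (+ suc n) = refl
  fromℤ-neg -[1+ n ]  = sym (-‿involutive _)

  fromℤ-homomorphism :
    CommutativeRing.rawRing ℤ.+-*-commutativeRing -Raw-AlmostCommutative⟶ fromCommutativeRing R
  fromℤ-homomorphism = record
    { ⟦_⟧    = fromℤ
    ; +-homo = fromℤ-+
    ; *-homo = fromℤ-*
    ; -‿homo = fromℤ-neg
    ; 0-homo = refl
    ; 1-homo = refl
    }

  fromℤ-≟ : ∀ i j → Maybe (fromℤ i ≈ fromℤ j)
  fromℤ-≟ i j with i ℤ.≟ j
  ... | yes i≡j = just (reflexive (≡.cong fromℤ i≡j))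
  ... | no  _   = nothing

  open import Algebra.Solver.Ring _ _ fromℤ-homomorphism fromℤ-≟ public
    using (Polynomial; solve; con; _:=_; _:+_; _:*_; _:-_; :-_)

  #_ : ∀ {m} → ℕ → Polynomial m
  # n = con (+ n)

-- Ordered fields: square roots and excluded middle from completeness

module OrderedField (ℝ : CompleteOrderedField) where
  open CompleteOrderedField ℝ
  open IsStrictTotalOrder isStrictTotalOrder public using (compare; _≟_)
    renaming (trans to <-trans; irrefl to <-irrefl; <-respˡ-≈ to <-respˡ; <-respʳ-≈ to <-respʳ)

  <-strictTotalOrder : StrictTotalOrder _ _ _
  <-strictTotalOrder = record { isStrictTotalOrder = isStrictTotalOrder }

  open DecTotalOrder (Relation.Binary.Properties.StrictTotalOrder.decTotalOrder <-strictTotalOrder)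
    public using ()
    renaming (refl to ≤-refl; reflexive to ≤-reflexive; trans to ≤-trans; total to ≤-total;
              ≤-respˡ-≈ to ≤-respˡ; ≤-respʳ-≈ to ≤-respʳ)
  open IntegerCoefficients commutativeRing

  opaque
    <⇒≤ : ∀ {x y} → x < y → x ≤ y
    <⇒≤ = inj₁

    <-≤-trans : ∀ {x y z} → x < y → y ≤ z → x < z
    <-≤-trans x<y (inj₁ y<z) = <-trans x<y y<z
    <-≤-trans x<y (inj₂ y≈z) = <-respʳ y≈z x<y

    ≤-<-trans : ∀ {x y z} → x ≤ y → y < z → x < z
    ≤-<-trans (inj₁ x<y) y<z = <-trans x<y y<z
    ≤-<-trans (inj₂ x≈y) y<z = <-respˡ (sym x≈y) y<z

    ≤⇒≯ : ∀ {x y} → x ≤ y → ¬ (y < x)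
    ≤⇒≯ x≤y y<x = <-irrefl refl (≤-<-trans x≤y y<x)

    ≮⇒≥ : ∀ {x y} → ¬ (x < y) → y ≤ x
    ≮⇒≥ {x} {y} x≮y with compare x y
    ... | tri< x<y _ _ = contradiction x<y x≮y
    ... | tri≈ _ x≈y _ = inj₂ (sym x≈y)
    ... | tri> _ _ y<x = inj₁ y<x

    <-≤-connex : ∀ x y → x < y ⊎ y ≤ x
    <-≤-connex x y with compare x y
    ... | tri< x<y _ _ = inj₁ x<y
    ... | tri≈ _ x≈y _ = inj₂ (inj₂ (sym x≈y))
    ... | tri> _ _ y<x = inj₂ (inj₁ y<x)

    -- Inequalities are proved by exhibiting the difference of the two sides as a
    -- sum of products of non-negative terms; the ring solver checks the identity.
    <-by : ∀ {x y e} → 0# < e → x + e ≈ y → x < y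
    <-by {x} {y} {e} 0<e eq =
      <-respˡ (+-identityˡ x) (<-respʳ (trans (+-comm e x) eq) (+-monoˡ-< x 0<e))

    ≤-by : ∀ {x y e} → 0# ≤ e → x + e ≈ y → x ≤ y
    ≤-by (inj₁ 0<e) eq = inj₁ (<-by 0<e eq)
    ≤-by {x} (inj₂ 0≈e) eq = inj₂ (trans (sym (+-identityʳ x)) (trans (+-congˡ 0≈e) eq))

    <⇒0<y-x : ∀ {x y} → x < y → 0# < y - x
    <⇒0<y-x {x} x<y = <-respˡ (-‿inverseʳ x) (+-monoˡ-< (- x) x<y)

    ≤⇒0≤y-x : ∀ {x y} → x ≤ y → 0# ≤ y - x
    ≤⇒0≤y-x (inj₁ x<y) = inj₁ (<⇒0<y-x x<y)
    ≤⇒0≤y-x {x} {y} (inj₂ x≈y) = inj₂ (trans (sym (-‿inverseʳ x)) (+-congʳ x≈y))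

    +-nonNeg : ∀ {x y} → 0# ≤ x → 0# ≤ y → 0# ≤ x + y
    +-nonNeg {x} {y} 0≤x 0≤y = ≤-trans 0≤x (≤-by 0≤y refl)

    +-pos-nonNeg : ∀ {x y} → 0# < x → 0# ≤ y → 0# < x + y
    +-pos-nonNeg 0<x 0≤y = <-≤-trans 0<x (≤-by 0≤y refl)

    *-nonNeg : ∀ {x y} → 0# ≤ x → 0# ≤ y → 0# ≤ x * y
    *-nonNeg (inj₁ 0<x) (inj₁ 0<y) = inj₁ (*-pos 0<x 0<y)
    *-nonNeg {x} {y} (inj₁ _) (inj₂ 0≈y) = inj₂ (trans (sym (zeroʳ x)) (*-congˡ 0≈y))
    *-nonNeg {x} {y} (inj₂ 0≈x) _ = inj₂ (trans (sym (zeroˡ y)) (*-congʳ 0≈x))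

    x<0⇒0<-x : ∀ {x} → x < 0# → 0# < - x
    x<0⇒0<-x {x} x<0 = <-respʳ (+-identityˡ (- x)) (<⇒0<y-x x<0)

    x≤0⇒0≤-x : ∀ {x} → x ≤ 0# → 0# ≤ - x
    x≤0⇒0≤-x {x} x≤0 = ≤-respʳ (+-identityˡ (- x)) (≤⇒0≤y-x x≤0)

    x²-pos : ∀ {x} → x ≉ 0# → 0# < x * x
    x²-pos {x} x≉0 with compare 0# x
    ... | tri< 0<x _ _ = *-pos 0<x 0<x
    ... | tri≈ _ 0≈x _ = contradiction (sym 0≈x) x≉0
    ... | tri> _ _ x<0 = <-respʳ (solve 1 (λ a → (:- a) :* (:- a) := a :* a) refl x)
                           (*-pos (x<0⇒0<-x x<0) (x<0⇒0<-x x<0))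

    x²-nonNeg : ∀ x → 0# ≤ x * x
    x²-nonNeg x with x ≟ 0#
    ... | yes x≈0 = inj₂ (sym (trans (*-congʳ x≈0) (zeroˡ x)))
    ... | no  x≉0 = inj₁ (x²-pos x≉0)

    0<1 : 0# < 1#
    0<1 = <-respʳ (*-identityˡ 1#) (x²-pos (λ 1≈0 → 0≉1 (sym 1≈0)))

    0≤1 : 0# ≤ 1#
    0≤1 = inj₁ 0<1

    <⇒≉ : ∀ {x y} → x < y → y ≉ x
    <⇒≉ x<y y≈x = <-irrefl (sym y≈x) x<y

    *-cancel-pos : ∀ {x y} → 0# ≤ x → 0# < x * y → 0# < y
    *-cancel-pos {x} {y} 0≤x 0<xy with <-≤-connex 0# y
    ... | inj₁ 0<y = 0<y
    ... | inj₂ y≤0 = contradiction 0<xy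
      (≤⇒≯ (≤-by (*-nonNeg 0≤x (x≤0⇒0≤-x y≤0))
                  (solve 2 (λ a b → a :* b :+ a :* (:- b) := # 0) refl x y)))

    x*y≈0⇒x≈0⊎y≈0 : ∀ {x y} → x * y ≈ 0# → x ≈ 0# ⊎ y ≈ 0#
    x*y≈0⇒x≈0⊎y≈0 {x} {y} xy≈0 with x ≟ 0#
    ... | yes x≈0 = inj₁ x≈0
    ... | no  x≉0 with invertible x x≉0
    ...   | x⁻¹ , x⁻¹x≈1 , _ = inj₂ (trans (sym (*-identityˡ y)) (trans (*-congʳ (sym x⁻¹x≈1))
            (trans (*-assoc _ _ _) (trans (*-congˡ xy≈0) (zeroʳ _)))))

    recip : ∀ {x} → 0# < x → ∃[ y ] 0# < y × x * y ≈ 1#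
    recip {x} 0<x with invertible x (<⇒≉ 0<x)
    ... | y , _ , xy≈1 = y , *-cancel-pos (<⇒≤ 0<x) (<-respʳ (sym xy≈1) 0<1) , xy≈1

    -- ε = A / (A + K).
    shrink : ∀ {A K} → 0# < A → 0# ≤ K → ∃[ ε ] 0# < ε × ε ≤ 1# × ε * K < A
    shrink {A} {K} 0<A 0≤K with recip (+-pos-nonNeg 0<A 0≤K)
    ... | r , 0<r , eq = A * r , *-pos 0<A 0<r ,
      ≤-by (*-nonNeg 0≤K (<⇒≤ 0<r))
        (trans (solve 3 (λ a k s → a :* s :+ k :* s := (a :+ k) :* s) refl A K r) eq) ,
      <-by (*-pos 0<A (*-pos 0<A 0<r))
        (trans (solve 3 (λ a k s → a :* s :* k :+ a :* (a :* s) := a :* ((a :+ k) :* s)) refl A K r)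
          (trans (*-congˡ eq) (*-identityʳ A)))

    min-pos : ∀ {x y} → 0# < x → 0# < y → ∃[ z ] 0# < z × z ≤ x × z ≤ y
    min-pos {x} {y} 0<x 0<y with ≤-total x y
    ... | inj₁ x≤y = x , 0<x , ≤-refl , x≤y
    ... | inj₂ y≤x = y , 0<y , y≤x , ≤-refl

    -- The supremum of {0} ∪ {1 ∣ P} is positive exactly when P holds.
    lem : (P : Set) → Dec P
    lem P with complete (λ x → x ≈ 0# ⊎ x ≈ 1# × P) (0# , inj₁ refl)
                        (1# , λ { (inj₁ x≈0) → ≤-respˡ (sym x≈0) 0≤1 ; (inj₂ (x≈1 , _)) → inj₂ x≈1 })
    ... | s , bound , approx with <-≤-connex 0# s
    ...   | inj₂ s≤0 = no (λ p → ≤⇒≯ (≤-trans (bound (inj₂ (refl , p))) s≤0) 0<1)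
    ...   | inj₁ 0<s with approx 0<s
    ...     | x , inj₁ x≈0 , 0<x = contradiction (sym x≈0) (λ eq → <-irrefl eq 0<x)
    ...     | x , inj₂ (_ , p) , _ = yes p

  private
    module SquareRoot {a : Carrier} (0≤a : 0# ≤ a) where
      S : Carrier → Set
      S x = 0# ≤ x × x * x ≤ a

      0∈S : S 0#
      0∈S = ≤-refl , ≤-respˡ (sym (zeroˡ 0#)) 0≤a

      -- From x > 1 + a would follow x² > (1 + a)² > a. The bound 1 + a covers a < 1 and a ≥ 1 at
      -- once.
      bounded : ∀ {x} → S x → x ≤ 1# + a
      bounded {x} (0≤x , x²≤a) with <-≤-connex (1# + a) x
      ... | inj₂ x≤1+a = x≤1+a
      ... | inj₁ 1+a<x = contradiction (<-by
        (+-pos-nonNeg (*-pos (<⇒0<y-x 1+a<x) (+-pos-nonNeg 0<1 (+-nonNeg 0≤x 0≤a)))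
                      (+-nonNeg (+-nonNeg 0≤1 0≤a) (x²-nonNeg a)))
        (solve 2 (λ b y → b :+ ((y :- (# 1 :+ b)) :* (# 1 :+ (y :+ b)) :+ (# 1 :+ b :+ b :* b))
                          := y :* y) refl a x))
        (≤⇒≯ x²≤a)

      module _ {s : Carrier} (bound : UpperBound S s) (approx : ∀ {y} → y < s → ∃[ x ] S x × y < x) where
        0≤s : 0# ≤ s
        0≤s = bound 0∈S

        -- Otherwise take ε ≤ 1 with ε(2s + 1) < a - s²; then (s + ε)² ≤ a, and s + ε is a member of
        -- `S` beyond its supremum.
        s²≮a : ¬ (s * s < a)
        s²≮a s²<a with shrink (<⇒0<y-x s²<a) (+-nonNeg (+-nonNeg 0≤s 0≤s) 0≤1)
        ... | ε , 0<ε , ε≤1 , small = ≤⇒≯ (bound {s + ε} (+-nonNeg 0≤s (<⇒≤ 0<ε) , ≤-by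
          (+-nonNeg (<⇒≤ (<⇒0<y-x small)) (*-nonNeg (<⇒≤ 0<ε) (≤⇒0≤y-x ε≤1)))
          (solve 3 (λ b t e → (t :+ e) :* (t :+ e) :+ ((b :- t :* t :- e :* (t :+ t :+ # 1)) :+ e :* (# 1 :- e))
                              := b) refl a s ε)))
          (<-by 0<ε refl)

        -- Otherwise take ε with 2sε < s² - a. A member x with s - ε < x ≤ s has s² - x² = (s - x)(s
        -- + x) ≤ 2sε, hence x² > a.
        a≮s² : ¬ (a < s * s)
        a≮s² a<s² with shrink (<⇒0<y-x a<s²) (+-nonNeg 0≤s 0≤s)
        ... | ε , 0<ε , ε≤1 , small
          with approx (<-by 0<ε (solve 2 (λ t e → t :- e :+ e := t) refl s ε))
        ...   | x , (0≤x , x²≤a) , s-ε<x = ≤⇒≯ x²≤a (<-by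
          (+-pos-nonNeg (<⇒0<y-x small)
            (+-nonNeg (*-nonNeg (<⇒≤ (<⇒0<y-x s-ε<x)) (+-nonNeg 0≤s 0≤x))
                      (*-nonNeg (<⇒≤ 0<ε) (≤⇒0≤y-x (bound (0≤x , x²≤a))))))
          (solve 4 (λ b t e y →
              b :+ ((t :* t :- b :- e :* (t :+ t)) :+ ((y :- (t :- e)) :* (t :+ y) :+ e :* (t :- y)))
              := y :* y) refl a s ε x))

        s²≈a : s * s ≈ a
        s²≈a with compare (s * s) a
        ... | tri< s²<a _ _ = contradiction s²<a s²≮a
        ... | tri≈ _ eq _   = eq
        ... | tri> _ _ a<s² = contradiction a<s² a≮s²

  opaque
    sqrt : ∀ {a} → 0# ≤ a → ∃[ s ] 0# ≤ s × s * s ≈ a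
    sqrt {a} 0≤a with complete S (0# , 0∈S) (1# + a , bounded)
      where open SquareRoot 0≤a
    ... | s , bound , approx = s , bound 0∈S , s²≈a bound approx
      where open SquareRoot 0≤a

-- Complex numbers

module ComplexNumbers (ℝ : CompleteOrderedField) where
  open CompleteOrderedField ℝ
  open OrderedField ℝ
  open Complex ℝ
  open IntegerCoefficients commutativeRing

  opaque
    x+x≤y+y⇒x≤y : ∀ {x y} → x + x ≤ y + y → x ≤ y
    x+x≤y+y⇒x≤y {x} {y} 2x≤2y with <-≤-connex y x
    ... | inj₂ x≤y = x≤y
    ... | inj₁ y<x = contradiction
      (<-by (*-pos (+-pos-nonNeg 0<1 0≤1) (<⇒0<y-x y<x))
            (solve 2 (λ a b → b :+ b :+ (# 1 :+ # 1) :* (a :- b) := a :+ a) refl x y))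
      (≤⇒≯ 2x≤2y)

    x²≤y²⇒x≤y : ∀ {x y} → 0# ≤ y → x * x ≤ y * y → x ≤ y
    x²≤y²⇒x≤y {x} {y} 0≤y x²≤y² with <-≤-connex y x
    ... | inj₂ x≤y = x≤y
    ... | inj₁ y<x = contradiction
      (<-by (*-pos (<⇒0<y-x y<x) (+-pos-nonNeg (≤-<-trans 0≤y y<x) 0≤y))
            (solve 2 (λ a b → b :* b :+ (a :- b) :* (a :+ b) := a :* a) refl x y))
      (≤⇒≯ x²≤y²)

  private module R = RawRing ℂ-rawRing

  opaque
    ℂ-isCommutativeRing : IsCommutativeRing R._≈_ R._+_ R._*_ R.-_ R.0# R.1#
    ℂ-isCommutativeRing = record
      { isRing = record
        { +-isAbelianGroup = record
          { isGroup = record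
            { isMonoid = record
              { isSemigroup = record
                { isMagma = record
                  { isEquivalence = record
                    { refl  = refl , refl
                    ; sym   = λ { (p , q) → sym p , sym q }
                    ; trans = λ { (p , q) (p′ , q′) → trans p p′ , trans q q′ }
                    }
                  ; ∙-cong = λ { (p , q) (p′ , q′) → +-cong p p′ , +-cong q q′ }
                  }
                ; assoc = λ _ _ _ → +-assoc _ _ _ , +-assoc _ _ _
                }
              ; identity = (λ _ → +-identityˡ _ , +-identityˡ _) , (λ _ → +-identityʳ _ , +-identityʳ _)
              }
            ; inverse = (λ _ → -‿inverseˡ _ , -‿inverseˡ _) , (λ _ → -‿inverseʳ _ , -‿inverseʳ _)
            ; ⁻¹-cong = λ { (p , q) → -‿cong p , -‿cong q }
            }
          ; comm = λ _ _ → +-comm _ _ , +-comm _ _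
          }
        ; *-cong = λ { (p , q) (p′ , q′) →
            +-cong (*-cong p p′) (-‿cong (*-cong q q′)) , +-cong (*-cong p q′) (*-cong q p′) }
        ; *-assoc = λ { (a +i b) (c +i d) (e +i f) →
            solve 6 (λ a b c d e f → (a :* c :- b :* d) :* e :- (a :* d :+ b :* c) :* f
                                     := a :* (c :* e :- d :* f) :- b :* (c :* f :+ d :* e)) refl a b c d e f ,
            solve 6 (λ a b c d e f → (a :* c :- b :* d) :* f :+ (a :* d :+ b :* c) :* e
                                     := a :* (c :* f :+ d :* e) :+ b :* (c :* e :- d :* f)) refl a b c d e f }
        ; *-identity =
            (λ { (a +i b) → solve 2 (λ a b → # 1 :* a :- # 0 :* b := a) refl a b ,
                            solve 2 (λ a b → # 1 :* b :+ # 0 :* a := b) refl a b }) ,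
            (λ { (a +i b) → solve 2 (λ a b → a :* # 1 :- b :* # 0 := a) refl a b ,
                            solve 2 (λ a b → a :* # 0 :+ b :* # 1 := b) refl a b })
        ; distrib =
            (λ { (a +i b) (c +i d) (e +i f) →
              solve 6 (λ a b c d e f → a :* (c :+ e) :- b :* (d :+ f)
                                       := (a :* c :- b :* d) :+ (a :* e :- b :* f)) refl a b c d e f ,
              solve 6 (λ a b c d e f → a :* (d :+ f) :+ b :* (c :+ e)
                                       := (a :* d :+ b :* c) :+ (a :* f :+ b :* e)) refl a b c d e f }) ,
            (λ { (a +i b) (c +i d) (e +i f) →
              solve 6 (λ a b c d e f → (c :+ e) :* a :- (d :+ f) :* b
                                       := (c :* a :- d :* b) :+ (e :* a :- f :* b)) refl a b c d e f ,
              solve 6 (λ a b c d e f → (c :+ e) :* b :+ (d :+ f) :* a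
                                       := (c :* b :+ d :* a) :+ (e :* b :+ f :* a)) refl a b c d e f })
        }
      ; *-comm = λ { (a +i b) (c +i d) →
          solve 4 (λ a b c d → a :* c :- b :* d := c :* a :- d :* b) refl a b c d ,
          solve 4 (λ a b c d → a :* d :+ b :* c := c :* b :+ d :* a) refl a b c d }
      }

  ℂ-commutativeRing : CommutativeRing 0ℓ 0ℓ
  ℂ-commutativeRing = record { isCommutativeRing = ℂ-isCommutativeRing }

  open CommutativeRing ℂ-commutativeRing public using ()
    renaming ( _+_ to _+ℂ_; _*_ to _*ℂ_; _-_ to _-ℂ_; -_ to -ℂ_; 0# to 0ℂ; 1# to 1ℂ
             ; _≈_ to _≈ℂ_; _≉_ to _≉ℂ_; refl to reflℂ; sym to symℂ; trans to transℂ
             ; +-congˡ to +ℂ-congˡ; +-congʳ to +ℂ-congʳ; +-cong to +ℂ-cong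
             ; *-congˡ to *ℂ-congˡ; *-congʳ to *ℂ-congʳ; *-cong to *ℂ-cong
             ; semiring to ℂ-semiring; commutativeSemiring to ℂ-commutativeSemiring
             ; zeroˡ to zeroℂˡ; zeroʳ to zeroℂʳ; +-identityˡ to +ℂ-identityˡ; +-identityʳ to +ℂ-identityʳ
             ; *-identityˡ to *ℂ-identityˡ; *-identityʳ to *ℂ-identityʳ; *-assoc to *ℂ-assoc; *-comm to *ℂ-comm)

  -- The squared modulus, polynomial in the coordinates, so that the ring solver can handle every
  -- estimate.
  N : ℂ → Carrier
  N z = re z * re z + im z * im z

  opaque
    N-cong : ∀ {z w} → z ≈ℂ w → N z ≈ N w
    N-cong (p , q) = +-cong (*-cong p p) (*-cong q q)

    N-* : ∀ z w → N (z *ℂ w) ≈ N z * N w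
    N-* (a +i b) (c +i d) = solve 4 (λ a b c d →
      (a :* c :- b :* d) :* (a :* c :- b :* d) :+ (a :* d :+ b :* c) :* (a :* d :+ b :* c)
      := (a :* a :+ b :* b) :* (c :* c :+ d :* d)) refl a b c d

    N-nonNeg : ∀ z → 0# ≤ N z
    N-nonNeg z = +-nonNeg (x²-nonNeg (re z)) (x²-nonNeg (im z))

    infix 4 _≟ℂ_
    _≟ℂ_ : ∀ z w → Dec (z ≈ℂ w)
    z ≟ℂ w with re z ≟ re w | im z ≟ im w
    ... | yes p | yes q = yes (p , q)
    ... | no ¬p | _     = no (λ { (p , _) → ¬p p })
    ... | _     | no ¬q = no (λ { (_ , q) → ¬q q })

    N-pos : ∀ {z} → z ≉ℂ 0ℂ → 0# < N z
    N-pos {z} z≉0 with re z ≟ 0# | im z ≟ 0#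
    ... | no re≉0 | _       = +-pos-nonNeg (x²-pos re≉0) (x²-nonNeg (im z))
    ... | yes _   | no im≉0 = <-respʳ (+-comm _ _) (+-pos-nonNeg (x²-pos im≉0) (x²-nonNeg (re z)))
    ... | yes p   | yes q   = contradiction (p , q) z≉0

    N0≈0 : N 0ℂ ≈ 0#
    N0≈0 = solve 0 (# 0 :* # 0 :+ # 0 :* # 0 := # 0) refl

    N-pos⁻¹ : ∀ {z} → 0# < N z → z ≉ℂ 0ℂ
    N-pos⁻¹ 0<Nz z≈0 = <⇒≉ 0<Nz (trans (N-cong z≈0) N0≈0)

    z*w≉0 : ∀ {z w} → z ≉ℂ 0ℂ → w ≉ℂ 0ℂ → z *ℂ w ≉ℂ 0ℂ
    z*w≉0 {z} {w} z≉0 w≉0 = N-pos⁻¹ (<-respʳ (sym (N-* z w)) (*-pos (N-pos z≉0) (N-pos w≉0)))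

    recipℂ : ∀ {z} → z ≉ℂ 0ℂ → ∃[ w ] z *ℂ w ≈ℂ 1ℂ
    recipℂ {a +i b} z≉0 with recip (N-pos z≉0)
    ... | r , _ , Nz*r≈1 = (a * r +i - (b * r)) ,
      (trans (solve 3 (λ a b r → a :* (a :* r) :- b :* (:- (b :* r)) := (a :* a :+ b :* b) :* r) refl a b r) Nz*r≈1) ,
      solve 3 (λ a b r → a :* (:- (b :* r)) :+ b :* (a :* r) := # 0) refl a b r

    -- The parallelogram law with |z - w|² dropped; it stands in for the triangle inequality.
    N-+-≤ : ∀ z w → N (z +ℂ w) ≤ (N z + N z) + (N w + N w)
    N-+-≤ (a +i b) (c +i d) = ≤-by (+-nonNeg (x²-nonNeg (a - c)) (x²-nonNeg (b - d)))
      (solve 4 (λ a b c d →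
        (a :+ c) :* (a :+ c) :+ (b :+ d) :* (b :+ d) :+ ((a :- c) :* (a :- c) :+ (b :- d) :* (b :- d))
        := ((a :* a :+ b :* b) :+ (a :* a :+ b :* b)) :+ ((c :* c :+ d :* d) :+ (c :* c :+ d :* d)))
        refl a b c d)

    fromReal-+ : ∀ a b → fromReal (a + b) ≈ℂ fromReal a +ℂ fromReal b
    fromReal-+ a b = refl , sym (+-identityˡ 0#)

    fromReal-* : ∀ a b → fromReal (a * b) ≈ℂ fromReal a *ℂ fromReal b
    fromReal-* a b = solve 2 (λ a b → a :* b := a :* b :- # 0 :* # 0) refl a b ,
                     solve 2 (λ a b → # 0 := a :* # 0 :+ # 0 :* b) refl a b

    -- √(x + iy) = √((r + x) / 2) ± i √((r - x) / 2) with r = |x + iy|.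
    sqrtℂ : ∀ z → ∃[ w ] w *ℂ w ≈ℂ z
    sqrtℂ z@(x +i y) with sqrt (N-nonNeg z) | recip (+-pos-nonNeg 0<1 0≤1)
    ... | r , 0≤r , r²≈N | h , 0<h , 2h≈1
      with sqrt (*-nonNeg (<⇒≤ 0<h) 0≤r+x) | sqrt (*-nonNeg (<⇒≤ 0<h) 0≤r-x)
      where
      x²≤r² : x * x ≤ r * r
      x²≤r² = ≤-by (x²-nonNeg y) (sym r²≈N)
      0≤r-x : 0# ≤ r - x
      0≤r-x = ≤⇒0≤y-x (x²≤y²⇒x≤y 0≤r x²≤r²)
      0≤r+x : 0# ≤ r + x
      0≤r+x = ≤-respʳ (solve 2 (λ r x → r :- (:- x) := r :+ x) refl r x)
        (≤⇒0≤y-x (x²≤y²⇒x≤y 0≤r (≤-respˡ (solve 1 (λ x → x :* x := (:- x) :* (:- x)) refl x) x²≤r²)))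
    ... | s , _ , s²≈h[r+x] | t , _ , t²≈h[r-x] = root (x*y≈0⇒x≈0⊎y≈0 product≈0)
      where
      re-eq : s * s - t * t ≈ x
      re-eq = trans (+-cong s²≈h[r+x] (-‿cong t²≈h[r-x]))
        (trans (solve 3 (λ h r x → h :* (r :+ x) :- h :* (r :- x) := (# 1 :+ # 1) :* h :* x) refl h r x)
          (trans (*-congʳ 2h≈1) (*-identityˡ x)))

      -- 4s²t² = r² - x² = y², hence 2st = y or 2st = -y; this decides the sign of the imaginary
      -- part of the root.
      product≈0 : (s * t + t * s - y) * (s * t + t * s + y) ≈ 0#
      product≈0 = trans
        (solve 3 (λ s t y → (s :* t :+ t :* s :- y) :* (s :* t :+ t :* s :+ y)
           := (# 1 :+ # 1) :* (# 1 :+ # 1) :* ((s :* s) :* (t :* t)) :- y :* y) refl s t y)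
        (trans (+-congʳ (trans (*-congˡ (*-cong s²≈h[r+x] t²≈h[r-x]))
          (trans (solve 3 (λ h r x →
              (# 1 :+ # 1) :* (# 1 :+ # 1) :* (h :* (r :+ x) :* (h :* (r :- x)))
              := ((# 1 :+ # 1) :* h) :* ((# 1 :+ # 1) :* h) :* (r :* r :- x :* x)) refl h r x)
            (*-cong (*-cong 2h≈1 2h≈1) (+-congʳ r²≈N)))))
          (solve 2 (λ x y → # 1 :* # 1 :* (x :* x :+ y :* y :- x :* x) :- y :* y := # 0) refl x y))

      root : s * t + t * s - y ≈ 0# ⊎ s * t + t * s + y ≈ 0# → ∃[ w ] w *ℂ w ≈ℂ x +i y
      root (inj₁ eq) = (s +i t) , re-eq ,
        trans (solve 3 (λ s t y → s :* t :+ t :* s := (s :* t :+ t :* s :- y) :+ y) refl s t y)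
              (trans (+-congʳ eq) (+-identityˡ y))
      root (inj₂ eq) = (s +i - t) ,
        trans (solve 2 (λ s t → s :* s :- (:- t) :* (:- t) := s :* s :- t :* t) refl s t) re-eq ,
        trans (solve 3 (λ s t y → s :* (:- t) :+ (:- t) :* s := y :- (s :* t :+ t :* s :+ y)) refl s t y)
              (trans (+-congˡ (trans (-‿cong eq) (solve 0 (:- # 0 := # 0) refl))) (+-identityʳ y))

-- Values of complex polynomials

module ComplexPolynomials (ℝ : CompleteOrderedField) where
  open CompleteOrderedField ℝ
  open OrderedField ℝ
  open Complex ℝ
  open ComplexNumbers ℝ
  open Stability ℝ using (module ℂ[x])
  open ℂ[x] using (Poly; coeff) renaming (eval to ev)

  -- Replaces the degree: `Nonzero p` says that `c ∷ p` is not constant.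
  Nonzero : Poly → Set
  Nonzero p = ∃[ k ] coeff p k ≉ℂ 0ℂ

  -- The quotient of c ∷ p by X - α; it does not depend on c.
  quotient : ℂ → Poly → Poly
  quotient α []      = []
  quotient α (d ∷ p) = ev (d ∷ p) α ∷ quotient α p

  length-quotient : ∀ α p → length (quotient α p) ≡ length p
  length-quotient α []      = ≡.refl
  length-quotient α (d ∷ p) = cong suc (length-quotient α p)

  module _ where
    open IntegerCoefficients ℂ-commutativeRing

    opaque
      ev-quotient : ∀ c p α z → ev (c ∷ p) z ≈ℂ ev (c ∷ p) α +ℂ (z -ℂ α) *ℂ ev (quotient α p) z
      ev-quotient c []      α z =
        solve 3 (λ c α z → c :+ z :* # 0 := c :+ α :* # 0 :+ (z :- α) :* # 0) reflℂ c α z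
      ev-quotient c (d ∷ p) α z = transℂ (+ℂ-congˡ (*ℂ-congˡ (ev-quotient d p α z)))
        (solve 5 (λ c α z e q → c :+ z :* (e :+ (z :- α) :* q) := c :+ α :* e :+ (z :- α) :* (e :+ z :* q))
          reflℂ c α z (ev (d ∷ p) α) (ev (quotient α p) z))

      ev-≈0 : ∀ p → (∀ k → coeff p k ≈ℂ 0ℂ) → ∀ z → ev p z ≈ℂ 0ℂ
      ev-≈0 []      _   z = reflℂ
      ev-≈0 (c ∷ p) p≈0 z = transℂ (+ℂ-cong (p≈0 0) (*ℂ-congˡ (ev-≈0 p (λ k → p≈0 (suc k)) z)))
                                   (solve 1 (λ z → # 0 :+ z :* # 0 := # 0) reflℂ z)

  module _ where
    open IntegerCoefficients commutativeRing

    opaque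
      ¬Nonzero⇒≈0 : ∀ p → ¬ Nonzero p → ∀ k → coeff p k ≈ℂ 0ℂ
      ¬Nonzero⇒≈0 p p≈0 k = decidable-stable (coeff p k ≟ℂ 0ℂ) (λ pₖ≉0 → p≈0 (k , pₖ≉0))

      ev-bounded : ∀ p {B} → 0# ≤ B → ∃[ K ] 0# ≤ K × (∀ z → N z ≤ B → N (ev p z) ≤ K)
      ev-bounded [] _ = 0# , ≤-refl , λ _ _ → ≤-reflexive N0≈0
      ev-bounded (c ∷ p) {B} 0≤B with ev-bounded p 0≤B
      ... | K , 0≤K , p≤K =
        N c + N c + (B * K + B * K) ,
        +-nonNeg (+-nonNeg (N-nonNeg c) (N-nonNeg c)) (+-nonNeg (*-nonNeg 0≤B 0≤K) (*-nonNeg 0≤B 0≤K)) ,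
        λ z Nz≤B → ≤-trans (N-+-≤ c (z *ℂ ev p z))
          (≤-by (+-nonNeg (+-nonNeg (*-nonNeg (≤⇒0≤y-x Nz≤B) 0≤K) (*-nonNeg (N-nonNeg z) (≤⇒0≤y-x (p≤K z Nz≤B))))
                          (+-nonNeg (*-nonNeg (≤⇒0≤y-x Nz≤B) 0≤K) (*-nonNeg (N-nonNeg z) (≤⇒0≤y-x (p≤K z Nz≤B)))))
            (trans (+-congʳ (+-congˡ (+-cong (N-* z (ev p z)) (N-* z (ev p z)))))
              (solve 5 (λ a b k x y →
                a :+ a :+ (x :* y :+ x :* y) :+ (((b :- x) :* k :+ x :* (k :- y)) :+ ((b :- x) :* k :+ x :* (k :- y)))
                := a :+ a :+ (b :* k :+ b :* k)) refl (N c) B K (N z) (N (ev p z)))))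

    BoundedBelow : Poly → Carrier → Carrier → Set
    BoundedBelow p c R = ∀ z → R ≤ N z → c ≤ N (ev p z)

    opaque
      -- Writing z p(z) as (a + z p(z)) - a gives |z|² c ≤ 2|a + z p(z)|² + 2|a|². The choice R′ = R
      -- + (2B + 2|a|²) / c makes the left side at least 2B + 2|a|².
      horner-grows : ∀ p a {c R B} → 0# < c → 1# ≤ R → BoundedBelow p c R → 0# ≤ B →
                     ∃[ R′ ] 1# ≤ R′ × BoundedBelow (a ∷ p) B R′
      horner-grows p a {c} {R} {B} 0<c 1≤R p≥c 0≤B with recip 0<c
      ... | r , 0<r , cr≈1 = R + M * r , ≤-trans 1≤R (≤-by 0≤Mr refl) , bound
        where
        M : Carrier
        M = (B + B) + (N a + N a)
        0≤Mr : 0# ≤ M * r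
        0≤Mr = *-nonNeg (+-nonNeg (+-nonNeg 0≤B 0≤B) (+-nonNeg (N-nonNeg a) (N-nonNeg a))) (<⇒≤ 0<r)
        bound : ∀ z → R + M * r ≤ N z → B ≤ N (ev (a ∷ p) z)
        bound z R+Mr≤Nz = x+x≤y+y⇒x≤y (≤-by (≤⇒0≤y-x (≤-trans M≤Nz*c (≤-trans Nz*c≤Nz*Np triangle)))
          (solve 3 (λ b n v → b :+ b :+ ((v :+ v :+ (n :+ n)) :- (b :+ b :+ (n :+ n))) := v :+ v)
            refl B (N a) (N (ev (a ∷ p) z))))
          where
          R≤Nz : R ≤ N z
          R≤Nz = ≤-trans (≤-by 0≤Mr refl) R+Mr≤Nz
          0≤R : 0# ≤ R
          0≤R = ≤-trans 0≤1 1≤R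
          M≤Nz*c : M ≤ N z * c
          M≤Nz*c = ≤-by (+-nonNeg (*-nonNeg (≤⇒0≤y-x R+Mr≤Nz) (<⇒≤ 0<c)) (*-nonNeg 0≤R (<⇒≤ 0<c)))
            (trans (solve 5 (λ m r ρ c x → m :+ ((x :- (r :+ m :* ρ)) :* c :+ r :* c) := x :* c :+ m :* (# 1 :- c :* ρ))
                     refl M R r c (N z))
              (trans (+-congˡ (trans (*-congˡ (trans (+-congˡ (-‿cong cr≈1)) (-‿inverseʳ 1#))) (zeroʳ M)))
                     (+-identityʳ _)))
          Nz*c≤Nz*Np : N z * c ≤ N z * N (ev p z)
          Nz*c≤Nz*Np = ≤-by (*-nonNeg (N-nonNeg z) (≤⇒0≤y-x (p≥c z R≤Nz)))
            (solve 3 (λ x c y → x :* c :+ x :* (y :- c) := x :* y) refl (N z) c (N (ev p z)))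
          triangle : N z * N (ev p z) ≤ (N (ev (a ∷ p) z) + N (ev (a ∷ p) z)) + (N a + N a)
          triangle = ≤-respˡ (trans (N-cong (isolate z)) (N-* z (ev p z)))
            (≤-respʳ (+-congˡ (+-cong (N-neg a) (N-neg a))) (N-+-≤ (ev (a ∷ p) z) (-ℂ a)))
            where
            isolate : ∀ z → ev (a ∷ p) z -ℂ a ≈ℂ z *ℂ ev p z
            isolate z = solve 2 (λ u v → u :+ v :- u := v) refl _ _ , solve 2 (λ u v → u :+ v :- u := v) refl _ _
            N-neg : ∀ w → N (-ℂ w) ≈ N w
            N-neg (x +i y) = solve 2 (λ x y → (:- x) :* (:- x) :+ (:- y) :* (:- y) := x :* x :+ y :* y) refl x y

    opaque
      -- Induction on the list. A non-zero tail is bounded below far out, and Horner's step then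
      -- makes the whole exceed 1; a zero tail leaves the constant a.
      ev-boundedBelow : ∀ p → Nonzero p → ∃[ c ] ∃[ R ] 0# < c × 1# ≤ R × BoundedBelow p c R
      ev-boundedBelow [] (_ , 0≉0) = contradiction reflℂ 0≉0
      ev-boundedBelow (a ∷ p) (k , aₖ≉0) with lem (Nonzero p)
      ... | yes p≉0 with ev-boundedBelow p p≉0
      ...   | c , R , 0<c , 1≤R , p≥c with horner-grows p a 0<c 1≤R p≥c 0≤1
      ...     | R′ , 1≤R′ , ap≥1 = 1# , R′ , 0<1 , 1≤R′ , ap≥1
      ev-boundedBelow (a ∷ p) (zero  , a≉0) | no p≈0 =
        N a , 1# , N-pos a≉0 , ≤-refl , λ z _ → ≤-reflexive (N-cong (symℂ
          (transℂ (+ℂ-congˡ (transℂ (*ℂ-congˡ (ev-≈0 p (¬Nonzero⇒≈0 p p≈0) z)) (zeroℂʳ z))) (+ℂ-identityʳ a))))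
      ev-boundedBelow (a ∷ p) (suc k , pₖ≉0) | no p≈0 = contradiction (k , pₖ≉0) p≈0

      ev-grows : ∀ a p {B} → Nonzero p → 0# ≤ B → ∃[ R ] 1# ≤ R × BoundedBelow (a ∷ p) B R
      ev-grows a p p≉0 0≤B with ev-boundedBelow p p≉0
      ... | _ , _ , 0<c , 1≤R , p≥c = horner-grows p a 0<c 1≤R p≥c 0≤B

-- Directions of descent

module Directions (ℝ : CompleteOrderedField) where
  open CompleteOrderedField ℝ
  open OrderedField ℝ
  open Complex ℝ
  open ComplexNumbers ℝ
  open Algebra.Properties.CommutativeSemiring.Exp ℂ-commutativeSemiring public using ()
    renaming (_^_ to _^ℂ_; ^-congˡ to ^ℂ-congˡ; ^-homo-* to ^ℂ-homo-*; ^-distrib-* to ^ℂ-distrib-*)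

  opaque
    even⊎odd : ∀ n → (∃[ j ] n ≡ j ℕ.+ j) ⊎ (∃[ j ] n ≡ suc (j ℕ.+ j))
    even⊎odd zero = inj₁ (0 , ≡.refl)
    even⊎odd (suc n) with even⊎odd n
    ... | inj₁ (j , ≡.refl) = inj₂ (j , ≡.refl)
    ... | inj₂ (j , ≡.refl) = inj₁ (suc j , cong suc (≡.sym (ℕ.+-suc j j)))

  module _ where
    open IntegerCoefficients ℂ-commutativeRing

    opaque
      ^ℂ-even : ∀ u j → u ^ℂ (j ℕ.+ j) ≈ℂ (u *ℂ u) ^ℂ j
      ^ℂ-even u j = transℂ (^ℂ-homo-* u j j) (symℂ (^ℂ-distrib-* u u j))

      1^ℂ : ∀ j → 1ℂ ^ℂ j ≈ℂ 1ℂ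
      1^ℂ zero    = reflℂ
      1^ℂ (suc j) = transℂ (*ℂ-identityˡ _) (1^ℂ j)

      -1^ℂ : ∀ j → (-ℂ 1ℂ) ^ℂ j ≈ℂ 1ℂ ⊎ (-ℂ 1ℂ) ^ℂ j ≈ℂ -ℂ 1ℂ
      -1^ℂ zero = inj₁ reflℂ
      -1^ℂ (suc j) with -1^ℂ j
      ... | inj₁ eq = inj₂ (transℂ (*ℂ-congˡ eq) (solve 0 ((:- # 1) :* # 1 := :- # 1) reflℂ))
      ... | inj₂ eq = inj₁ (transℂ (*ℂ-congˡ eq) (solve 0 ((:- # 1) :* (:- # 1) := # 1) reflℂ))

      ^ℂ-odd-neg : ∀ u j → (-ℂ u) ^ℂ suc (j ℕ.+ j) ≈ℂ -ℂ (u ^ℂ suc (j ℕ.+ j))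
      ^ℂ-odd-neg u j = transℂ
        (*ℂ-congˡ (transℂ (^ℂ-even (-ℂ u) j)
          (transℂ (^ℂ-congˡ j (solve 1 (λ u → (:- u) :* (:- u) := u :* u) reflℂ u)) (symℂ (^ℂ-even u j)))))
        (solve 2 (λ u v → (:- u) :* v := :- (u :* v)) reflℂ u _)

  module _ where
    open IntegerCoefficients commutativeRing

    opaque
      re-*i : ∀ w → re (w *ℂ (0# +i 1#)) ≈ - im w
      re-*i (x +i y) = solve 2 (λ x y → x :* # 0 :- y :* # 1 := :- y) refl x y

      re-*-neg : ∀ w v → re (w *ℂ -ℂ v) ≈ - re (w *ℂ v)
      re-*-neg (x +i y) (a +i b) =
        solve 4 (λ x y a b → x :* (:- a) :- y :* (:- b) := :- (x :* a :- y :* b)) refl x y a b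

      -x≉0 : ∀ {x} → x ≉ 0# → - x ≉ 0#
      -x≉0 {x} x≉0 -x≈0 = x≉0 (trans (solve 1 (λ x → x := :- (:- x)) refl x)
                                (trans (-‿cong -x≈0) (solve 0 (:- # 0 := # 0) refl)))

      i²≈-1 : (0# +i 1#) *ℂ (0# +i 1#) ≈ℂ -ℂ 1ℂ
      i²≈-1 = solve 0 (# 0 :* # 0 :- # 1 :* # 1 := :- # 1) refl ,
              solve 0 (# 0 :* # 1 :+ # 1 :* # 0 := :- # 0) refl

  opaque
    i^ℂodd : ∀ j → (0# +i 1#) ^ℂ suc (j ℕ.+ j) ≈ℂ 0# +i 1# ⊎ (0# +i 1#) ^ℂ suc (j ℕ.+ j) ≈ℂ -ℂ (0# +i 1#)
    i^ℂodd j with -1^ℂ j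
    ... | inj₁ eq = inj₁ (transℂ (*ℂ-congˡ (transℂ (^ℂ-even _ j) (transℂ (^ℂ-congˡ j i²≈-1) eq))) (*ℂ-identityʳ _))
    ... | inj₂ eq = inj₂ (transℂ (*ℂ-congˡ (transℂ (^ℂ-even _ j) (transℂ (^ℂ-congˡ j i²≈-1) eq)))
                                 (solve 1 (λ i → i :* (:- # 1) := :- i) reflℂ (0# +i 1#)))
      where open IntegerCoefficients ℂ-commutativeRing

    -- An odd power of i is i or -i, so u = 1 tests the real part of w and u = i its imaginary part
    -- up to sign; one of them is non-zero.
    re-odd≉0 : ∀ j {w} → w ≉ℂ 0ℂ → ∃[ u ] re (w *ℂ (u ^ℂ suc (j ℕ.+ j))) ≉ 0#
    re-odd≉0 j {w} w≉0 with re w ≟ 0#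
    ... | no re≉0 = 1ℂ , λ eq → re≉0
      (trans (proj₁ (transℂ (symℂ (*ℂ-identityʳ w)) (*ℂ-congˡ {w} (symℂ (1^ℂ (suc (j ℕ.+ j))))))) eq)
    ... | yes re≈0 with i^ℂodd j
    ...   | inj₁ eq = (0# +i 1#) , λ eq′ → -x≉0 (λ im≈0 → w≉0 (re≈0 , im≈0))
      (trans (sym (re-*i w)) (trans (proj₁ (*ℂ-congˡ {w} (symℂ eq))) eq′))
    ...   | inj₂ eq = (0# +i 1#) , λ eq′ → -x≉0 (-x≉0 (λ im≈0 → w≉0 (re≈0 , im≈0)))
      (trans (-‿cong (sym (re-*i w))) (trans (sym (re-*-neg w _)) (trans (proj₁ (*ℂ-congˡ {w} (symℂ eq))) eq′)))

  -- For odd k one of ±1, ±i works, and an even k is halved by taking a square root of u.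
  opaque
    descentDirection : ∀ k {w} → w ≉ℂ 0ℂ → ∃[ u ] re (w *ℂ (u ^ℂ suc k)) < 0#
    descentDirection = <-rec _ go
      where
      go : ∀ k → (∀ {j} → j ℕ.< k → ∀ {w} → w ≉ℂ 0ℂ → ∃[ u ] re (w *ℂ (u ^ℂ suc j)) < 0#) →
           ∀ {w} → w ≉ℂ 0ℂ → ∃[ u ] re (w *ℂ (u ^ℂ suc k)) < 0#
      go k rec {w} w≉0 with even⊎odd k
      -- The exponent is `suc k`, so an even index k means an odd exponent; there u may be replaced
      -- by -u to make the real part negative.
      ... | inj₁ (j , ≡.refl) with re-odd≉0 j w≉0
      ...   | u , re≉0 with compare (re (w *ℂ (u ^ℂ suc (j ℕ.+ j)))) 0#
      ...     | tri< re<0 _ _ = u , re<0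
      ...     | tri≈ _ re≈0 _ = contradiction re≈0 re≉0
      ...     | tri> _ _ re>0 = (-ℂ u) , <-respˡ
        (trans (sym (re-*-neg w _)) (proj₁ (*ℂ-congˡ {w} (symℂ (^ℂ-odd-neg u j)))))
        (<-by re>0 (-‿inverseˡ _))
      go k rec {w} w≉0 | inj₂ (j , ≡.refl) with rec (ℕ.s≤s (ℕ.m≤m+n j j)) w≉0
      ...   | u , re<0 with sqrtℂ u
      ...     | r , r²≈u = r , <-respˡ
        (proj₁ (*ℂ-congˡ {w} (symℂ (transℂ (≡.subst (λ n → r ^ℂ n ≈ℂ (r *ℂ r) ^ℂ suc j) (cong suc (ℕ.+-suc j j))
                                                   (^ℂ-even r (suc j)))
                                    (^ℂ-congˡ (suc j) r²≈u)))))
        re<0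

-- The minimum of |p|

module Minimum (ℝ : CompleteOrderedField) where
  open CompleteOrderedField ℝ
  open OrderedField ℝ
  open Complex ℝ
  open ComplexNumbers ℝ
  open ComplexPolynomials ℝ
  open Stability ℝ using (module ℂ[x])
  open ℂ[x] using (Poly) renaming (eval to ev)
  open IntegerCoefficients commutativeRing

  -- The sets on which |p| comes arbitrarily close to its infimum form a grill, and
  -- cutting along the two coordinates concentrates this grill at a point.
  record Grill (F : (ℂ → Set) → Set) : Set₁ where
    field
      mono  : ∀ {S T} → (∀ {z} → S z → T z) → F S → F T
      split : ∀ {S T} → F (λ z → S z ⊎ T z) → F S ⊎ F T

  ⋂ : (Carrier → (ℂ → Set) → Set) → (ℂ → Set) → Set
  ⋂ F S = ∀ t → 0# < t → F t S

  Between : Carrier → Carrier → Carrier → Set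
  Between a δ x = a - δ < x × x < a + δ

  opaque
    Between-mono : ∀ {a δ ε x} → δ ≤ ε → Between a δ x → Between a ε x
    Between-mono {a} {δ} {ε} δ≤ε (l , u) =
      ≤-<-trans (≤-by (≤⇒0≤y-x δ≤ε) (solve 3 (λ a d e → a :- e :+ (e :- d) := a :- d) refl a δ ε)) l ,
      <-≤-trans u (≤-by (≤⇒0≤y-x δ≤ε) (solve 3 (λ a d e → a :+ d :+ (e :- d) := a :+ e) refl a δ ε))

    -- If `F t S` fails for one t, it fails for all smaller parameters. Splitting at r = min(s, t)
    -- must then yield T, and monotonicity lifts this from r to s.
    ⋂-grill : ∀ {F} → (∀ t → Grill (F t)) → (∀ {s t S} → s ≤ t → F s S → F t S) → Grill (⋂ F)
    ⋂-grill {F} grill incr = record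
      { mono  = λ S⊆T FS t 0<t → Grill.mono (grill t) S⊆T (FS t 0<t)
      ; split = split′
      }
      where
      split′ : ∀ {S T} → ⋂ F (λ z → S z ⊎ T z) → ⋂ F S ⊎ ⋂ F T
      split′ {S} {T} F[S∪T] with lem (∃[ t ] 0# < t × ¬ F t S)
      ... | no ¬∃ = inj₁ (λ t 0<t → decidable-stable (lem (F t S)) (λ ¬FtS → ¬∃ (t , 0<t , ¬FtS)))
      ... | yes (t , 0<t , ¬FtS) = inj₂ right
        where
        right : ⋂ F T
        right s 0<s with min-pos 0<s 0<t
        ... | r , 0<r , r≤s , r≤t with Grill.split (grill r) (F[S∪T] r 0<r)
        ...   | inj₁ FrS = contradiction (incr r≤t FrS) ¬FtS
        ...   | inj₂ FrT = incr r≤s FrT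

    -- Let a be the supremum of all x whose set {c ≥ x} lies in `F`. Then {c ≥ a - δ} lies in `F`
    -- and {c ≥ a + δ} does not, so splitting leaves the strip between them. The bounds l and u make
    -- the supremum exist.
    localise : ∀ {F} → Grill F → F (λ _ → ⊤) → ∀ (c : ℂ → Carrier) {l u} →
               ¬ F (λ z → c z ≤ l) → ¬ F (λ z → u ≤ c z) →
               ∃[ a ] ∀ δ → 0# < δ → F (λ z → Between a δ (c z))
    localise {F} grill full c {l} {u} ¬F≤l ¬F≥u
      with complete (λ x → F (λ z → x ≤ c z)) (l , l∈S) (u , bounded)
      where
      open Grill grill
      l∈S : F (λ z → l ≤ c z)
      l∈S with split (mono (λ {z} _ → ≤-total (c z) l) full)
      ... | inj₁ F≤l = contradiction F≤l ¬F≤l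
      ... | inj₂ F≥l = F≥l
      bounded : ∀ {x} → F (λ z → x ≤ c z) → x ≤ u
      bounded {x} F≥x with ≤-total x u
      ... | inj₁ x≤u = x≤u
      ... | inj₂ u≤x = contradiction (mono (≤-trans u≤x) F≥x) ¬F≥u
    ... | a , bound , approx = a , near
      where
      open Grill grill
      near : ∀ δ → 0# < δ → F (λ z → Between a δ (c z))
      near δ 0<δ with approx (<-by 0<δ (solve 2 (λ a d → a :- d :+ d := a) refl a δ))
      ... | x , F≥x , a-δ<x with split (mono (λ {z} x≤cz → cases z (<-≤-trans a-δ<x x≤cz)) F≥x)
        where
        cases : ∀ z → a - δ < c z → a + δ ≤ c z ⊎ Between a δ (c z)
        cases z a-δ<cz with <-≤-connex (c z) (a + δ)
        ... | inj₁ cz<a+δ = inj₂ (a-δ<cz , cz<a+δ)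
        ... | inj₂ a+δ≤cz = inj₁ a+δ≤cz
      ...   | inj₁ F≥a+δ = contradiction (<-by 0<δ refl) (≤⇒≯ (bound F≥a+δ))
      ...   | inj₂ Fnear = Fnear

    x≤1+x² : ∀ x → x ≤ 1# + x * x
    x≤1+x² x = x+x≤y+y⇒x≤y (≤-by (+-nonNeg (+-nonNeg (x²-nonNeg (x - 1#)) 0≤1) (x²-nonNeg x))
      (solve 1 (λ x → x :+ x :+ ((x :- # 1) :* (x :- # 1) :+ # 1 :+ x :* x) := # 1 :+ x :* x :+ (# 1 :+ x :* x)) refl x))

    -- |(x - a) X| ≤ δ|X| ≤ δ(1 + X²) ≤ δB; the bound 1 + X² takes the place of |X| and is
    -- polynomial.
    -δB≤dx : ∀ {a δ x B X} → Between a δ x → X * X + 1# ≤ B → - (δ * B) ≤ (x - a) * X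
    -δB≤dx {a} {δ} {x} {B} {X} (l , u) X²+1≤B = x+x≤y+y⇒x≤y (≤-by
      (+-nonNeg
        (*-nonNeg (<⇒≤ (<⇒0<y-x l)) (+-nonNeg (≤⇒0≤y-x X²+1≤B) (≤⇒0≤y-x (x≤1+x² (- X)))))
        (*-nonNeg (<⇒≤ (<⇒0<y-x u)) (+-nonNeg (≤⇒0≤y-x X²+1≤B) (≤⇒0≤y-x (x≤1+x² X)))))
      (solve 5 (λ a d x b y →
        (:- (d :* b)) :+ (:- (d :* b))
        :+ ((x :- (a :- d)) :* ((b :- (y :* y :+ # 1)) :+ (# 1 :+ (:- y) :* (:- y) :- (:- y)))
        :+ (a :+ d :- x) :* ((b :- (y :* y :+ # 1)) :+ (# 1 :+ y :* y :- y)))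
        := (x :- a) :* y :+ (x :- a) :* y) refl a δ x B X))

  Near : ℂ → Carrier → ℂ → Set
  Near z₀ δ z = Between (re z₀) δ (re z) × Between (im z₀) δ (im z)

  opaque
    d²≤1 : ∀ {a δ x} → δ ≤ 1# → Between a δ x → (x - a) * (x - a) ≤ 1#
    d²≤1 {a} {δ} {x} δ≤1 near with Between-mono δ≤1 near
    ... | l , u = ≤-by (*-nonNeg (<⇒≤ (<⇒0<y-x l)) (<⇒≤ (<⇒0<y-x u)))
      (solve 2 (λ a x → (x :- a) :* (x :- a) :+ (x :- (a :- # 1)) :* (a :+ # 1 :- x) := # 1) refl a x)

    Near⇒N≤ : ∀ {z₀ δ z} → δ ≤ 1# → Near z₀ δ z → N z ≤ (N z₀ + N z₀) + ((1# + 1#) + (1# + 1#))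
    Near⇒N≤ {z₀} {δ} {z} δ≤1 (nre , nim) = ≤-trans
      (≤-respˡ (N-cong z₀+[z-z₀]≈z) (N-+-≤ z₀ (z -ℂ z₀)))
      (≤-by (+-nonNeg Nd≤2 Nd≤2)
        (solve 2 (λ a d → a :+ a :+ (d :+ d) :+ (# 1 :+ # 1 :- d :+ (# 1 :+ # 1 :- d))
                          := a :+ a :+ (# 1 :+ # 1 :+ (# 1 :+ # 1))) refl (N z₀) (N (z -ℂ z₀))))
      where
      z₀+[z-z₀]≈z : z₀ +ℂ (z -ℂ z₀) ≈ℂ z
      z₀+[z-z₀]≈z = solve 2 (λ u v → u :+ (v :- u) := v) refl _ _ , solve 2 (λ u v → u :+ (v :- u) := v) refl _ _
      Nd≤2 : 0# ≤ 1# + 1# - N (z -ℂ z₀)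
      Nd≤2 = ≤-respʳ (solve 2 (λ x y → # 1 :- x :+ (# 1 :- y) := # 1 :+ # 1 :- (x :+ y)) refl _ _)
        (+-nonNeg (≤⇒0≤y-x (d²≤1 δ≤1 nre)) (≤⇒0≤y-x (d²≤1 δ≤1 nim)))

    -- The cross term 2 re(p̄ d s) is separated into its parts along `re d` and `im d`, each of
    -- which has the shape that `-δB≤dx` bounds.
    N-+-expand : ∀ p d s → N (p +ℂ d *ℂ s) ≈
      N p + ((re d * (re p * re s + im p * im s) + re d * (re p * re s + im p * im s))
      + (im d * (im p * re s - re p * im s) + im d * (im p * re s - re p * im s)) + N (d *ℂ s))
    N-+-expand (a +i b) (x +i y) (g +i h) = solve 6 (λ a b x y g h →
      (a :+ (x :* g :- y :* h)) :* (a :+ (x :* g :- y :* h)) :+ (b :+ (x :* h :+ y :* g)) :* (b :+ (x :* h :+ y :* g))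
      := (a :* a :+ b :* b) :+ ((x :* (a :* g :+ b :* h) :+ x :* (a :* g :+ b :* h))
         :+ (y :* (b :* g :- a :* h) :+ y :* (b :* g :- a :* h))
         :+ ((x :* g :- y :* h) :* (x :* g :- y :* h) :+ (x :* h :+ y :* g) :* (x :* h :+ y :* g))))
      refl a b x y g h

    -- Lagrange's identity: this inner product and the one in `⟨ip,s⟩²+1≤` have squares summing to
    -- |p|²|s|². The summand 1 fits the hypothesis of `-δB≤dx`.
    ⟨p,s⟩²+1≤ : ∀ p s {K} → N s ≤ K → (re p * re s + im p * im s) * (re p * re s + im p * im s) + 1# ≤ N p * K + 1#
    ⟨p,s⟩²+1≤ p@(a +i b) s@(g +i h) {K} Ns≤K = ≤-by
      (+-nonNeg (x²-nonNeg (b * g - a * h)) (*-nonNeg (N-nonNeg p) (≤⇒0≤y-x Ns≤K)))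
      (solve 5 (λ a b g h k →
        (a :* g :+ b :* h) :* (a :* g :+ b :* h) :+ # 1
        :+ ((b :* g :- a :* h) :* (b :* g :- a :* h) :+ (a :* a :+ b :* b) :* (k :- (g :* g :+ h :* h)))
        := (a :* a :+ b :* b) :* k :+ # 1) refl a b g h K)

    ⟨ip,s⟩²+1≤ : ∀ p s {K} → N s ≤ K → (im p * re s - re p * im s) * (im p * re s - re p * im s) + 1# ≤ N p * K + 1#
    ⟨ip,s⟩²+1≤ p@(a +i b) s@(g +i h) {K} Ns≤K = ≤-by
      (+-nonNeg (x²-nonNeg (a * g + b * h)) (*-nonNeg (N-nonNeg p) (≤⇒0≤y-x Ns≤K)))
      (solve 5 (λ a b g h k →
        (b :* g :- a :* h) :* (b :* g :- a :* h) :+ # 1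
        :+ ((a :* g :+ b :* h) :* (a :* g :+ b :* h) :+ (a :* a :+ b :* b) :* (k :- (g :* g :+ h :* h)))
        := (a :* a :+ b :* b) :* k :+ # 1) refl a b g h K)

  opaque
    -- p(z) = p(z₀) + (z - z₀) s(z), with s bounded on the box of half-width 1. In the expansion of
    -- |p(z)|² the square |(z - z₀) s|² only helps a lower bound, and the cross terms are of order
    -- δ.
    lowerSemicontinuous : ∀ c p z₀ {y} → y < N (ev (c ∷ p) z₀) →
                          ∃[ δ ] 0# < δ × (∀ z → Near z₀ δ z → y ≤ N (ev (c ∷ p) z))
    lowerSemicontinuous c p z₀ {y} y<v
      with ev-bounded (quotient z₀ p) {(N z₀ + N z₀) + ((1# + 1#) + (1# + 1#))}
             (+-nonNeg (+-nonNeg (N-nonNeg z₀) (N-nonNeg z₀)) (+-nonNeg (+-nonNeg 0≤1 0≤1) (+-nonNeg 0≤1 0≤1)))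
    ... | K , 0≤K , q≤K
      -- Four times B: there are two cross terms, each occurring twice and each at least -δB.
      with shrink (<⇒0<y-x y<v) (+-nonNeg (+-nonNeg 0≤B 0≤B) (+-nonNeg 0≤B 0≤B))
      where
      B : Carrier
      B = N (ev (c ∷ p) z₀) * K + 1#
      0≤B : 0# ≤ B
      0≤B = +-nonNeg (*-nonNeg (N-nonNeg (ev (c ∷ p) z₀)) 0≤K) 0≤1
    ... | δ , 0<δ , δ≤1 , small = δ , 0<δ , bound
      where
      p₀ : ℂ
      p₀ = ev (c ∷ p) z₀
      bound : ∀ z → Near z₀ δ z → y ≤ N (ev (c ∷ p) z)
      bound z near@(nre , nim) = ≤-respʳ (sym (trans (N-cong (ev-quotient c p z₀ z)) (N-+-expand p₀ (z -ℂ z₀) s)))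
        (≤-by (+-nonNeg (+-nonNeg (<⇒≤ (<⇒0<y-x small)) (+-nonNeg (+-nonNeg x-bound x-bound) (+-nonNeg y-bound y-bound)))
                        (N-nonNeg ((z -ℂ z₀) *ℂ s)))
          (solve 7 (λ y v d b x1 x2 n → y :+ (v :- y :- d :* (b :+ b :+ (b :+ b))
              :+ (x1 :- (:- (d :* b)) :+ (x1 :- (:- (d :* b))) :+ (x2 :- (:- (d :* b)) :+ (x2 :- (:- (d :* b))))) :+ n)
              := v :+ (x1 :+ x1 :+ (x2 :+ x2) :+ n)) refl y (N p₀) δ (N p₀ * K + 1#)
              (re (z -ℂ z₀) * (re p₀ * re s + im p₀ * im s)) (im (z -ℂ z₀) * (im p₀ * re s - re p₀ * im s))
              (N ((z -ℂ z₀) *ℂ s))))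
        where
        s : ℂ
        s = ev (quotient z₀ p) z
        Ns≤K : N s ≤ K
        Ns≤K = q≤K z (Near⇒N≤ δ≤1 near)
        x-bound : 0# ≤ (re z - re z₀) * (re p₀ * re s + im p₀ * im s) - - (δ * (N p₀ * K + 1#))
        x-bound = ≤⇒0≤y-x (-δB≤dx nre (⟨p,s⟩²+1≤ p₀ s Ns≤K))
        y-bound : 0# ≤ (im z - im z₀) * (im p₀ * re s - re p₀ * im s) - - (δ * (N p₀ * K + 1#))
        y-bound = ≤⇒0≤y-x (-δB≤dx nim (⟨ip,s⟩²+1≤ p₀ s Ns≤K))

    -- Completeness speaks of suprema, so m is the supremum of the lower bounds of v.
    infimum : (v : ℂ → Carrier) → (∀ z → 0# ≤ v z) →
              ∃[ m ] (∀ z → m ≤ v z) × (∀ {y} → m < y → ∃[ z ] v z < y)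
    infimum v 0≤v with complete (λ y → ∀ z → y ≤ v z) (0# , 0≤v) (v 0ℂ , λ lower → lower 0ℂ)
    ... | m , bound , approx = m , lower , reached
      where
      lower : ∀ z → m ≤ v z
      lower z = ≮⇒≥ λ vz<m → let y , y≤v , vz<y = approx vz<m in ≤⇒≯ (y≤v z) vz<y
      reached : ∀ {y} → m < y → ∃[ z ] v z < y
      reached {y} m<y = decidable-stable (lem _) λ ¬∃ →
        ≤⇒≯ (bound (λ z → ≮⇒≥ λ vz<y → ¬∃ (z , vz<y))) m<y

    -- R ≤ R² when R ≥ 1. Thus one number R bounds both a coordinate and a squared modulus, which is
    -- why radii are kept at least 1.
    R≤x² : ∀ {R x} → 1# ≤ R → R ≤ x ⊎ x ≤ - R → R ≤ x * x
    R≤x² {R} {x} 1≤R (inj₁ R≤x) = ≤-by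
      (+-nonNeg (*-nonNeg (≤⇒0≤y-x R≤x) (+-nonNeg (≤-trans 0≤R R≤x) 0≤R)) (*-nonNeg 0≤R (≤⇒0≤y-x 1≤R)))
      (solve 2 (λ r x → r :+ ((x :- r) :* (x :+ r) :+ r :* (r :- # 1)) := x :* x) refl R x)
      where
      0≤R : 0# ≤ R
      0≤R = ≤-trans 0≤1 1≤R
    R≤x² {R} {x} 1≤R (inj₂ x≤-R) = ≤-by
      (+-nonNeg (*-nonNeg (≤⇒0≤y-x x≤-R) (+-nonNeg (+-nonNeg (≤⇒0≤y-x x≤-R) 0≤R) 0≤R)) (*-nonNeg 0≤R (≤⇒0≤y-x 1≤R)))
      (solve 2 (λ r x → r :+ (((:- r) :- x) :* ((:- r) :- x :+ r :+ r) :+ r :* (r :- # 1)) := x :* x) refl R x)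
      where
      0≤R : 0# ≤ R
      0≤R = ≤-trans 0≤1 1≤R

  module _ (v : ℂ → Carrier) (m : Carrier) where
    NearInf : Carrier → (ℂ → Set) → Set
    NearInf t S = ∃[ z ] S z × v z < m + t

    opaque
      NearInf-grill : Grill (⋂ NearInf)
      NearInf-grill = ⋂-grill
        (λ t → record { mono  = λ { S⊆T (z , Sz , lt) → z , S⊆T Sz , lt }
                      ; split = λ { (z , inj₁ Sz , lt) → inj₁ (z , Sz , lt) ; (z , inj₂ Tz , lt) → inj₂ (z , Tz , lt) } })
        (λ { {s} {t} s≤t (z , Sz , lt) → z , Sz , <-≤-trans lt
          (≤-by (≤⇒0≤y-x s≤t) (solve 3 (λ m s t → m :+ s :+ (t :- s) := m :+ t) refl m s t)) })

    opaque
      -- The grill for the second cut: it keeps the first coordinate confined to every strip about a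
      -- while the other coordinate is localised.
      Between-grill : ∀ a → Grill (⋂ (λ δ S → ⋂ NearInf (λ z → Between a δ (re z) × S z)))
      Between-grill a = ⋂-grill
        (λ δ → record
          { mono  = λ S⊆T → Grill.mono NearInf-grill (λ { (b , Sz) → b , S⊆T Sz })
          ; split = λ F → Grill.split NearInf-grill (Grill.mono NearInf-grill
              (λ { (b , inj₁ Sz) → inj₁ (b , Sz) ; (b , inj₂ Tz) → inj₂ (b , Tz) }) F) })
        (λ δ≤ε → Grill.mono NearInf-grill (λ { (b , Sz) → Between-mono δ≤ε b , Sz }))

    module _ {t R : Carrier} (0<t : 0# < t) (1≤R : 1# ≤ R) (v≥ : ∀ z → R ≤ N z → m + t ≤ v z) where
      opaque
        -- Where the coordinate x has modulus at least R, the squared modulus of z is at least R and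
        -- v exceeds m by t or more, so v does not come near m there.
        bounded : (x : ℂ → Carrier) → (∀ z → x z * x z ≤ N z) →
                  ∀ {S : ℂ → Set} → (∀ {z} → S z → R ≤ x z ⊎ x z ≤ - R) → ¬ ⋂ NearInf S
        bounded x x²≤N far F with F t 0<t
        ... | z , Sz , vz<m+t = ≤⇒≯ (v≥ z (≤-trans (R≤x² 1≤R (far Sz)) (x²≤N z))) vz<m+t

        re²≤N : ∀ z → re z * re z ≤ N z
        re²≤N z = ≤-by (x²-nonNeg (im z)) refl

        im²≤N : ∀ z → im z * im z ≤ N z
        im²≤N z = ≤-by (x²-nonNeg (re z)) (+-comm _ _)

      opaque
        clusterPoint : ⋂ NearInf (λ _ → ⊤) → ∃[ z₀ ] ∀ δ → 0# < δ → ⋂ NearInf (Near z₀ δ)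
        clusterPoint full
          with localise NearInf-grill full re { - R } {R} (bounded re re²≤N inj₂) (bounded re re²≤N inj₁)
        ... | a , near-a
          with localise (Between-grill a)
            (λ δ 0<δ → Grill.mono NearInf-grill (_, tt) (near-a δ 0<δ)) im { - R } {R}
            (λ F → bounded im im²≤N (λ { (_ , far) → inj₂ far }) (F 1# 0<1))
            (λ F → bounded im im²≤N (λ { (_ , far) → inj₁ far }) (F 1# 0<1))
        ...   | b , near-b = (a +i b) , λ δ 0<δ → near-b δ 0<δ δ 0<δ

  LowerSemicontinuous : (ℂ → Carrier) → Set
  LowerSemicontinuous v = ∀ z₀ {y} → y < v z₀ → ∃[ δ ] 0# < δ × (∀ z → Near z₀ δ z → y ≤ v z)

  Coercive : (ℂ → Carrier) → Set
  Coercive v = ∀ {B} → 0# ≤ B → ∃[ R ] 1# ≤ R × (∀ z → R ≤ N z → B ≤ v z)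

  opaque
    cluster-≤inf : ∀ {v} → LowerSemicontinuous v → ∀ {m z₀} →
                   (∀ δ → 0# < δ → ⋂ (NearInf v m) (Near z₀ δ)) → v z₀ ≤ m
    cluster-≤inf {v} lsc {m} {z₀} near = ≮⇒≥ contra
      where
      contra : ¬ (m < v z₀)
      contra m<v with shrink (<⇒0<y-x m<v) 0≤1
      ... | ε , 0<ε , _ , ε<gap with lsc z₀ {m + ε}
            (<-by (<⇒0<y-x ε<gap) (solve 3 (λ m e v → m :+ e :+ (v :- m :- e :* # 1) := v) refl m ε (v z₀)))
      ...   | δ , 0<δ , bound with near δ 0<δ ε 0<ε
      ...     | z , nz , vz<m+ε = ≤⇒≯ (bound z nz) vz<m+ε

  opaque
    attainsMinimum : ∀ v → (∀ z → 0# ≤ v z) → LowerSemicontinuous v → Coercive v →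
                     ∃[ z₀ ] ∀ z → v z₀ ≤ v z
    attainsMinimum v v-nonNeg lsc coercive with infimum v v-nonNeg
    -- The bound is v(0) + 1, written as m + t with t = v(0) - m + 1 > 0 to match `clusterPoint`.
    ... | m , lower , reached with coercive {m + (v 0ℂ - m + 1#)} (≤-trans (v-nonNeg 0ℂ)
          (≤-by 0≤1 (solve 2 (λ v m → v :+ # 1 := m :+ (v :- m :+ # 1)) refl (v 0ℂ) m)))
    ...   | R , 1≤R , v≥ with clusterPoint v m
            (<-respʳ (+-comm 1# (v 0ℂ - m)) (+-pos-nonNeg 0<1 (≤⇒0≤y-x (lower 0ℂ)))) 1≤R v≥
            (λ t 0<t → let z , vz<m+t = reached (<-by 0<t refl) in z , tt , vz<m+t)
    ...     | z₀ , near = z₀ , λ z → ≤-trans (cluster-≤inf lsc near) (lower z)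

  opaque
    ev-attainsMinimum : ∀ c p → Nonzero p → ∃[ z₀ ] ∀ z → N (ev (c ∷ p) z₀) ≤ N (ev (c ∷ p) z)
    ev-attainsMinimum c p p≉0 = attainsMinimum (λ z → N (ev (c ∷ p) z)) (λ z → N-nonNeg (ev (c ∷ p) z))
      (lowerSemicontinuous c p) (ev-grows c p p≉0)

-- The fundamental theorem of algebra

module FundamentalTheorem (ℝ : CompleteOrderedField) where
  open CompleteOrderedField ℝ
  open OrderedField ℝ
  open Complex ℝ
  open ComplexNumbers ℝ
  open ComplexPolynomials ℝ
  open Directions ℝ
  open Minimum ℝ
  open Stability ℝ using (module ℂ[x])
  open ℂ[x] using (Poly) renaming (eval to ev)

  conj : ℂ → ℂ
  conj z = re z +i - im z

  module _ where
    open IntegerCoefficients ℂ-commutativeRing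

    opaque
      -- Division by X - z₀ is repeated until the quotient no longer vanishes at z₀; each quotient
      -- is shorter, so this ends. The index n makes the recursion structural, since a quotient is
      -- not a sublist.
      factorOut : ∀ z₀ n p → length p ≡ n →
        (∀ z → ev p z ≈ℂ 0ℂ) ⊎
        (∃[ k ] ∃[ q ] ev q z₀ ≉ℂ 0ℂ × (∀ z → ev p z ≈ℂ (z -ℂ z₀) ^ℂ k *ℂ ev q z))
      factorOut z₀ _ [] _ = inj₁ (λ _ → reflℂ)
      factorOut z₀ (suc n) (c ∷ p) len with ev (c ∷ p) z₀ ≟ℂ 0ℂ
      ... | no ≉0 = inj₂ (0 , c ∷ p , ≉0 , λ z → symℂ (*ℂ-identityˡ _))
      ... | yes ≈0 with factorOut z₀ n (quotient z₀ p) (≡.trans (length-quotient z₀ p) (ℕ.suc-injective len))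
      ...   | inj₁ q≈0 = inj₁ (λ z → transℂ (ev-quotient c p z₀ z)
                (transℂ (+ℂ-cong ≈0 (*ℂ-congˡ (q≈0 z))) (solve 1 (λ d → # 0 :+ d :* # 0 := # 0) reflℂ (z -ℂ z₀))))
      ...   | inj₂ (k , q , q≉0 , eq) = inj₂ (suc k , q , q≉0 , λ z → transℂ (ev-quotient c p z₀ z)
                (transℂ (+ℂ-cong ≈0 (*ℂ-congˡ (eq z)))
                  (solve 3 (λ d e q → # 0 :+ d :* (e :* q) := d :* e :* q) reflℂ (z -ℂ z₀) ((z -ℂ z₀) ^ℂ k) (ev q z))))

      z₀+d-z₀≈d : ∀ z₀ d → (z₀ +ℂ d) -ℂ z₀ ≈ℂ d
      z₀+d-z₀≈d = solve 2 (λ z d → z :+ d :- z := d) reflℂ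

      regroup : ∀ T u q → (T *ℂ u) *ℂ q ≈ℂ T *ℂ (u *ℂ q)
      regroup = solve 3 (λ t u q → (t :* u) :* q := t :* (u :* q)) reflℂ

      -- Used with q(z) = q(z₀) + t u s: the product p̄ uᵏ⁺¹ q(z) splits into its value at z₀, whose
      -- real part is negative by the choice of u, and a remainder with a factor t.
      expand : ∀ p u q t v s → p *ℂ (u *ℂ (q +ℂ (t *ℂ v) *ℂ s)) ≈ℂ (p *ℂ q) *ℂ u +ℂ t *ℂ (p *ℂ ((v *ℂ u) *ℂ s))
      expand = solve 6 (λ p u q t v s → p :* (u :* (q :+ (t :* v) :* s))
                                        := (p :* q) :* u :+ t :* (p :* ((v :* u) :* s))) reflℂ

  module _ where
    open IntegerCoefficients commutativeRing

    opaque
      conj-≉0 : ∀ {z} → z ≉ℂ 0ℂ → conj z ≉ℂ 0ℂ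
      conj-≉0 {a +i b} z≉0 = N-pos⁻¹
        (<-respʳ (solve 2 (λ a b → a :* a :+ b :* b := a :* a :+ (:- b) :* (:- b)) refl a b) (N-pos z≉0))

      N-perturb : ∀ p t e → N (p +ℂ fromReal t *ℂ e) ≈
                  N p + t * ((re (conj p *ℂ e) + re (conj p *ℂ e)) + t * N e)
      N-perturb (a +i b) t (x +i y) = solve 5 (λ a b t x y →
        (a :+ (t :* x :- # 0 :* y)) :* (a :+ (t :* x :- # 0 :* y))
        :+ (b :+ (t :* y :+ # 0 :* x)) :* (b :+ (t :* y :+ # 0 :* x))
        := (a :* a :+ b :* b) :+ t :* ((a :* x :- (:- b) :* y) :+ (a :* x :- (:- b) :* y)
           :+ t :* (x :* x :+ y :* y))) refl a b t x y

      re-real* : ∀ t w → re (fromReal t *ℂ w) ≈ t * re w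
      re-real* t (x +i y) = solve 3 (λ t x y → t :* x :- # 0 :* y := t :* x) refl t x y

      2re-conj≤ : ∀ p x → re (conj p *ℂ x) + re (conj p *ℂ x) ≤ N p + N x
      2re-conj≤ (a +i b) (x +i y) = ≤-by (+-nonNeg (x²-nonNeg (a - x)) (x²-nonNeg (b - y)))
        (solve 4 (λ a b x y → (a :* x :- (:- b) :* y) :+ (a :* x :- (:- b) :* y)
          :+ ((a :- x) :* (a :- x) :+ (b :- y) :* (b :- y)) := (a :* a :+ b :* b) :+ (x :* x :+ y :* y)) refl a b x y)

      N-fromReal : ∀ t → N (fromReal t) ≈ t * t
      N-fromReal = solve 1 (λ t → t :* t :+ # 0 :* # 0 := t :* t) refl

      fromReal-^ : ∀ k {t} → 0# < t → t ≤ 1# →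
                   ∃[ T ] 0# < T × T ≤ t × fromReal t ^ℂ suc k ≈ℂ fromReal T
      fromReal-^ zero    {t} 0<t t≤1 = t , 0<t , ≤-refl , *ℂ-identityʳ _
      fromReal-^ (suc k) {t} 0<t t≤1 with fromReal-^ k 0<t t≤1
      ... | T , 0<T , T≤t , eq = t * T , *-pos 0<t 0<T ,
        ≤-by (*-nonNeg (<⇒≤ 0<t) (≤⇒0≤y-x (≤-trans T≤t t≤1)))
          (solve 2 (λ t T → t :* T :+ t :* (# 1 :- T) := t) refl t T) ,
        transℂ (*ℂ-congˡ eq) (symℂ (fromReal-* t T))

    -- With A = - re (p̄ q uᵏ⁺¹) > 0 one has |p + tᵏ⁺¹ uᵏ⁺¹ q|² < |p|² as soon as t times
    -- the bounded part of the expansion is smaller than A.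
    opaque
      bracket<0 : ∀ {A t T r ρ x n a P M₁ M₂} → 0# < A → 0# ≤ t → 0# ≤ T → T ≤ t → r ≈ - A + t * ρ →
                  ρ + ρ ≤ P + x → x ≤ M₁ → n ≤ M₂ → 0# ≤ M₂ → t * (P + M₁ + M₂) < A → a ≈ (r + r) + T * n → a < 0#
      bracket<0 {A} {t} {T} {r} {ρ} {x} {n} {a} {P} {M₁} {M₂} 0<A 0≤t 0≤T T≤t r≈ ρ≤ x≤ n≤ 0≤M₂ small a≈ =
        <-respˡ (sym (trans a≈ (+-congʳ (+-cong r≈ r≈)))) (<-by
          (+-pos-nonNeg (+-pos-nonNeg 0<A (<⇒≤ (<⇒0<y-x small)))
            (+-nonNeg (*-nonNeg 0≤t (+-nonNeg (≤⇒0≤y-x ρ≤) (≤⇒0≤y-x x≤)))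
              (+-nonNeg (*-nonNeg 0≤T (≤⇒0≤y-x n≤)) (*-nonNeg (≤⇒0≤y-x T≤t) 0≤M₂))))
          (solve 9 (λ A t T ρ x n P M₁ M₂ →
            ((:- A) :+ t :* ρ) :+ ((:- A) :+ t :* ρ) :+ T :* n
            :+ (A :+ (A :- t :* (P :+ M₁ :+ M₂)) :+ (t :* ((P :+ x :- (ρ :+ ρ)) :+ (M₁ :- x))
               :+ (T :* (M₂ :- n) :+ (t :- T) :* M₂)))
            := # 0) refl A t T ρ x n P M₁ M₂))

    opaque
      -- Move to z = z₀ + t u. The leading change of |p|² is 2tᵏ⁺¹ re(p̄ q(z₀) uᵏ⁺¹) < 0, and every
      -- other term carries a further factor t or tᵏ⁺¹ ≤ t.
      descend : ∀ p k c q z₀ → p ≉ℂ 0ℂ → ev (c ∷ q) z₀ ≉ℂ 0ℂ →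
                ∃[ z ] N (p +ℂ (z -ℂ z₀) ^ℂ suc k *ℂ ev (c ∷ q) z) < N p
      descend p k c q z₀ p≉0 q₀≉0 with descentDirection k (z*w≉0 (conj-≉0 p≉0) q₀≉0)
      ... | u , A<0
        -- The radius covers z₀ + t u for every t ≤ 1, so `K₁` and `K₂` are fixed before t is chosen
        -- in terms of them.
        with ev-bounded (c ∷ q) 0≤B | ev-bounded (quotient z₀ q) 0≤B
        where
        0≤B : 0# ≤ (N z₀ + N z₀) + (N u + N u)
        0≤B = +-nonNeg (+-nonNeg (N-nonNeg z₀) (N-nonNeg z₀)) (+-nonNeg (N-nonNeg u) (N-nonNeg u))
      ... | K₁ , 0≤K₁ , q≤K₁ | K₂ , 0≤K₂ , s≤K₂
        with shrink (x<0⇒0<-x A<0)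
          (+-nonNeg (+-nonNeg (N-nonNeg p) (*-nonNeg (N-nonNeg (u *ℂ u ^ℂ suc k)) 0≤K₂))
                    (*-nonNeg (N-nonNeg (u ^ℂ suc k)) 0≤K₁))
      ... | t , 0<t , t≤1 , small with fromReal-^ k 0<t t≤1
      ...   | T , 0<T , T≤t , tᵏ≈T = z , <-respˡ (sym (trans (N-cong value) (N-perturb p T e)))
        (<-by (*-pos 0<T (x<0⇒0<-x neg)) (solve 3 (λ n t b → n :+ t :* b :+ t :* (:- b) := n) refl (N p) T _))
        where
        z : ℂ
        z = z₀ +ℂ fromReal t *ℂ u
        e : ℂ
        e = u ^ℂ suc k *ℂ ev (c ∷ q) z
        s : ℂ
        s = ev (quotient z₀ q) z
        z-z₀ : z -ℂ z₀ ≈ℂ fromReal t *ℂ u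
        z-z₀ = z₀+d-z₀≈d z₀ (fromReal t *ℂ u)
        value : p +ℂ (z -ℂ z₀) ^ℂ suc k *ℂ ev (c ∷ q) z ≈ℂ p +ℂ fromReal T *ℂ e
        value = +ℂ-congˡ (transℂ
          (*ℂ-congʳ (transℂ (^ℂ-congˡ (suc k) z-z₀) (transℂ (^ℂ-distrib-* (fromReal t) u (suc k)) (*ℂ-congʳ tᵏ≈T))))
          (regroup (fromReal T) (u ^ℂ suc k) (ev (c ∷ q) z)))
        Nz≤B : N z ≤ (N z₀ + N z₀) + (N u + N u)
        Nz≤B = ≤-trans (N-+-≤ z₀ (fromReal t *ℂ u)) (≤-by (+-nonNeg tu≤u tu≤u)
          (solve 3 (λ a b c → a :+ a :+ (b :+ b) :+ (c :- b :+ (c :- b)) := a :+ a :+ (c :+ c))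
            refl (N z₀) (N (fromReal t *ℂ u)) (N u)))
          where
          tu≤u : 0# ≤ N u - N (fromReal t *ℂ u)
          tu≤u = ≤-respʳ
            (trans (solve 2 (λ t n → (# 1 :- t) :* ((# 1 :+ t) :* n) := n :- t :* t :* n) refl t (N u))
              (+-congˡ (-‿cong (sym (trans (N-* (fromReal t) u) (*-congʳ (N-fromReal t)))))))
            (*-nonNeg (≤⇒0≤y-x t≤1) (*-nonNeg (+-nonNeg 0≤1 (<⇒≤ 0<t)) (N-nonNeg u)))
        neg : (re (conj p *ℂ e) + re (conj p *ℂ e)) + T * N e < 0#
        neg = bracket<0 {ρ = re (conj p *ℂ ((u *ℂ u ^ℂ suc k) *ℂ s))}
          (x<0⇒0<-x A<0) (<⇒≤ 0<t) (<⇒≤ 0<T) T≤t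
          (trans (proj₁ (transℂ (*ℂ-congˡ {conj p} (*ℂ-congˡ {u ^ℂ suc k}
              (transℂ (ev-quotient c q z₀ z) (+ℂ-congˡ (*ℂ-congʳ z-z₀)))))
              (expand (conj p) (u ^ℂ suc k) (ev (c ∷ q) z₀) (fromReal t) u s)))
            (+-cong (solve 1 (λ a → a := :- (:- a)) refl _) (re-real* t _)))
          (2re-conj≤ p ((u *ℂ u ^ℂ suc k) *ℂ s))
          (≤-respˡ (sym (N-* (u *ℂ u ^ℂ suc k) s)) (scale (N-nonNeg (u *ℂ u ^ℂ suc k)) (s≤K₂ z Nz≤B)))
          (≤-respˡ (sym (N-* (u ^ℂ suc k) (ev (c ∷ q) z))) (scale (N-nonNeg (u ^ℂ suc k)) (q≤K₁ z Nz≤B)))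
          (*-nonNeg (N-nonNeg (u ^ℂ suc k)) 0≤K₁)
          small refl
          where
          scale : ∀ {a x y} → 0# ≤ a → x ≤ y → a * x ≤ a * y
          scale {a} {x} {y} 0≤a x≤y = ≤-by (*-nonNeg 0≤a (≤⇒0≤y-x x≤y))
            (solve 3 (λ a x y → a :* x :+ a :* (y :- x) := a :* y) refl a x y)

    opaque
      -- Factoring the quotient by X - z₀ gives p(z) = p(z₀) + (z - z₀)ᵏ⁺¹ q(z) with q(z₀) non-zero,
      -- the form in which `descend` applies.
      ¬locallyMinimal : ∀ c p z₀ → Nonzero p → ev (c ∷ p) z₀ ≉ℂ 0ℂ → ∃[ z ] N (ev (c ∷ p) z) < N (ev (c ∷ p) z₀)
      ¬locallyMinimal c p z₀ p≉0 v≉0 with factorOut z₀ (length p) (quotient z₀ p) (length-quotient z₀ p)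
      -- Here the polynomial would be constant, yet at z = R it reaches squared modulus |p(z₀)|² +
      -- 1.
      ... | inj₁ q≈0 = ⊥-elim
        (let R , 1≤R , v≥ = ev-grows c p p≉0 (+-nonNeg (N-nonNeg (ev (c ∷ p) z₀)) 0≤1) in
          ≤⇒≯ (v≥ (fromReal R) (≤-respʳ (sym (N-fromReal R)) (R≤x² 1≤R (inj₁ ≤-refl))))
          (<-by 0<1 (+-congʳ (N-cong (transℂ (ev-quotient c p z₀ (fromReal R))
            (transℂ (+ℂ-congˡ (transℂ (*ℂ-congˡ (q≈0 (fromReal R))) (zeroℂʳ _))) (+ℂ-identityʳ _)))))))
      ... | inj₂ (k , [] , q≉0 , eq) = contradiction reflℂ q≉0
      ... | inj₂ (k , d ∷ q , q≉0 , eq) with descend (ev (c ∷ p) z₀) k d q z₀ v≉0 q≉0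
      ...   | z , less = z , <-respˡ (N-cong (symℂ (transℂ (ev-quotient c p z₀ z)
                (+ℂ-congˡ (transℂ (*ℂ-congˡ (eq z)) (symℂ (*ℂ-assoc _ _ _))))))) less

    opaque
      hasRoot : ∀ c p → Nonzero p → ∃[ z ] ev (c ∷ p) z ≈ℂ 0ℂ
      hasRoot c p p≉0 with ev-attainsMinimum c p p≉0
      ... | z₀ , minimal with ev (c ∷ p) z₀ ≟ℂ 0ℂ
      ...   | yes ≈0 = z₀ , ≈0
      ...   | no  ≉0 with ¬locallyMinimal c p z₀ p≉0 ≉0
      ...     | z , less = contradiction less (≤⇒≯ (minimal z))

-- Real polynomials without zeros in the right half-plane

module RealPolynomials (ℝ : CompleteOrderedField) where
  open CompleteOrderedField ℝ
  open OrderedField ℝ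
  open Complex ℝ
  open ComplexNumbers ℝ
  open ComplexPolynomials ℝ using (Nonzero; ¬Nonzero⇒≈0)
  open FundamentalTheorem ℝ using (hasRoot)
  open Stability ℝ using (module ℝ[x]; module ℂ[x]; toℂ[x])
  open ℝ[x] using (Poly; coeff)

  ⟦_⟧ : Poly → ℂ → ℂ
  ⟦ p ⟧ = ℂ[x].eval (toℂ[x] p)

  AllCoeffs : (Carrier → Set) → Poly → Set
  AllCoeffs P p = ∀ k → P (coeff p k)

  -- Abstracts over the conditions 0 ≤ x and x ≤ 0, so that one argument serves both signs.
  record Cone (P : Carrier → Set) : Set where
    field
      0∈    : P 0#
      +-∈   : ∀ {x y} → P x → P y → P (x + y)
      *-∈   : ∀ {a x} → 0# ≤ a → P x → P (a * x)
      resp  : ∀ {x y} → x ≈ y → P x → P y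

  -- Division of c ∷ p by X + α; the quotient does not depend on c.
  remainder₁ : Carrier → Carrier → Poly → Carrier
  remainder₁ α c []      = c
  remainder₁ α c (d ∷ p) = c - α * remainder₁ α d p

  quotient₁ : Carrier → Poly → Poly
  quotient₁ α []      = []
  quotient₁ α (d ∷ p) = remainder₁ α d p ∷ quotient₁ α p

  -- Division of c ∷ d ∷ p by X² + βX + γ leaves the remainder rX + s.
  module _ (β γ : Carrier) where
    r s : Carrier → Carrier → Poly → Carrier
    r c d []      = d
    r c d (e ∷ p) = s d e p - β * r d e p
    s c d []      = c
    s c d (e ∷ p) = c - γ * r d e p

    quotient₂ : Carrier → Poly → Poly
    quotient₂ d []      = []
    quotient₂ d (e ∷ p) = r d e p ∷ quotient₂ e p

  opaque
    length-quotient₁ : ∀ α p → length (quotient₁ α p) ≡ length p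
    length-quotient₁ α []      = ≡.refl
    length-quotient₁ α (d ∷ p) = cong suc (length-quotient₁ α p)

    length-quotient₂ : ∀ β γ d p → length (quotient₂ β γ d p) ≡ length p
    length-quotient₂ β γ d []      = ≡.refl
    length-quotient₂ β γ d (e ∷ p) = cong suc (length-quotient₂ β γ e p)

  module _ where
    open IntegerCoefficients commutativeRing

    opaque
      nonNeg-cone : Cone (0# ≤_)
      nonNeg-cone = record { 0∈ = ≤-refl ; +-∈ = +-nonNeg ; *-∈ = *-nonNeg ; resp = ≤-respʳ }

      nonPos-cone : Cone (_≤ 0#)
      nonPos-cone = record
        { 0∈   = ≤-refl
        ; +-∈  = λ {x} {y} x≤0 y≤0 → ≤-by (+-nonNeg (x≤0⇒0≤-x x≤0) (x≤0⇒0≤-x y≤0))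
                   (solve 2 (λ x y → x :+ y :+ (:- x :+ (:- y)) := # 0) refl x y)
        ; *-∈  = λ {a} {x} 0≤a x≤0 → ≤-by (*-nonNeg 0≤a (x≤0⇒0≤-x x≤0))
                   (solve 2 (λ a x → a :* x :+ a :* (:- x) := # 0) refl a x)
        ; resp = ≤-respˡ
        }

      fromReal-sub* : ∀ a b c → fromReal (a - b * c) ≈ℂ fromReal a -ℂ fromReal b *ℂ fromReal c
      fromReal-sub* a b c =
        solve 3 (λ a b c → a :- b :* c := a :- (b :* c :- # 0 :* # 0)) refl a b c ,
        solve 2 (λ b c → # 0 := # 0 :- (b :* # 0 :+ # 0 :* c)) refl b c

      -- The division read on coefficients, through which signs pass from the quotient to the
      -- dividend; `eval-quotient₁` reads it on values, for the zeros.
      coeff-quotient₁ : ∀ α c p → let q = quotient₁ α p in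
        c ≈ remainder₁ α c p + α * coeff q 0 × (∀ k → coeff p k ≈ coeff q k + α * coeff q (suc k))
      coeff-quotient₁ α c [] =
        solve 2 (λ a c → c := c :+ a :* # 0) refl α c , λ k → solve 1 (λ a → # 0 := # 0 :+ a :* # 0) refl α
      coeff-quotient₁ α c (d ∷ p) with coeff-quotient₁ α d p
      ... | d≈ , p≈ = solve 3 (λ a c r → c := c :- a :* r :+ a :* r) refl α c (remainder₁ α d p) ,
        λ { zero → d≈ ; (suc k) → p≈ k }

      coeff-quotient₂ : ∀ β γ c d p → let q = quotient₂ β γ d p in
        c ≈ s β γ c d p + γ * coeff q 0 ×
        d ≈ r β γ c d p + (β * coeff q 0 + γ * coeff q 1) ×
        (∀ k → coeff p k ≈ coeff q k + (β * coeff q (suc k) + γ * coeff q (suc (suc k))))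
      coeff-quotient₂ β γ c d [] =
        solve 2 (λ g c → c := c :+ g :* # 0) refl γ c ,
        solve 3 (λ b g d → d := d :+ (b :* # 0 :+ g :* # 0)) refl β γ d ,
        λ k → solve 2 (λ b g → # 0 := # 0 :+ (b :* # 0 :+ g :* # 0)) refl β γ
      coeff-quotient₂ β γ c d (e ∷ p) with coeff-quotient₂ β γ d e p
      ... | d≈ , e≈ , p≈ =
        solve 3 (λ g c r → c := c :- g :* r :+ g :* r) refl γ c (r β γ d e p) ,
        trans d≈ (solve 5 (λ b g s r q → s :+ g :* q := s :- b :* r :+ (b :* r :+ g :* q)) refl
                    β γ (s β γ d e p) (r β γ d e p) (coeff (quotient₂ β γ e p) 0)) ,
        λ { zero → e≈ ; (suc k) → p≈ k }

  module _ where
    open IntegerCoefficients ℂ-commutativeRing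

    opaque
      eval-quotient₁ : ∀ α c p z →
        ⟦ c ∷ p ⟧ z ≈ℂ (z +ℂ fromReal α) *ℂ ⟦ quotient₁ α p ⟧ z +ℂ fromReal (remainder₁ α c p)
      eval-quotient₁ α c [] z = solve 3 (λ a c z → c :+ z :* # 0 := (z :+ a) :* # 0 :+ c) reflℂ (fromReal α) (fromReal c) z
      eval-quotient₁ α c (d ∷ p) z = transℂ (+ℂ-congˡ (*ℂ-congˡ (eval-quotient₁ α d p z)))
        (transℂ (solve 5 (λ a c z q r → c :+ z :* ((z :+ a) :* q :+ r) := (z :+ a) :* (r :+ z :* q) :+ (c :- a :* r))
                  reflℂ (fromReal α) (fromReal c) z (⟦ quotient₁ α p ⟧ z) (fromReal (remainder₁ α d p)))
                (+ℂ-congˡ (symℂ (fromReal-sub* c α (remainder₁ α d p)))))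

      eval-quotient₂ : ∀ β γ c d p z →
        ⟦ c ∷ d ∷ p ⟧ z ≈ℂ (z *ℂ z +ℂ fromReal β *ℂ z +ℂ fromReal γ) *ℂ ⟦ quotient₂ β γ d p ⟧ z
                           +ℂ (fromReal (r β γ c d p) *ℂ z +ℂ fromReal (s β γ c d p))
      eval-quotient₂ β γ c d [] z =
        solve 5 (λ b g c d z → c :+ z :* (d :+ z :* # 0) := (z :* z :+ b :* z :+ g) :* # 0 :+ (d :* z :+ c))
          reflℂ (fromReal β) (fromReal γ) (fromReal c) (fromReal d) z
      eval-quotient₂ β γ c d (e ∷ p) z = transℂ (+ℂ-congˡ (*ℂ-congˡ (eval-quotient₂ β γ d e p z)))
        (transℂ (solve 7 (λ b g c z q r s →
                    c :+ z :* ((z :* z :+ b :* z :+ g) :* q :+ (r :* z :+ s))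
                    := (z :* z :+ b :* z :+ g) :* (r :+ z :* q) :+ ((s :- b :* r) :* z :+ (c :- g :* r)))
                  reflℂ (fromReal β) (fromReal γ) (fromReal c) z (⟦ quotient₂ β γ e p ⟧ z)
                  (fromReal (r β γ d e p)) (fromReal (s β γ d e p)))
                (+ℂ-congˡ (+ℂ-cong (*ℂ-congʳ (symℂ (fromReal-sub* (s β γ d e p) β (r β γ d e p))))
                                   (symℂ (fromReal-sub* c γ (r β γ d e p))))))

      q≈0⇒qt+u≈0 : ∀ {q t u} → q ≈ℂ 0ℂ → u ≈ℂ 0ℂ → q *ℂ t +ℂ u ≈ℂ 0ℂ
      q≈0⇒qt+u≈0 {q} {t} {u} q≈0 u≈0 = transℂ (+ℂ-cong (*ℂ-congʳ q≈0) u≈0) (solve 1 (λ t → # 0 :* t :+ # 0 := # 0) reflℂ t)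

      t≈0⇒qt+u≈0 : ∀ {q t u} → t ≈ℂ 0ℂ → u ≈ℂ 0ℂ → q *ℂ t +ℂ u ≈ℂ 0ℂ
      t≈0⇒qt+u≈0 {q} {t} t≈0 u≈0 = transℂ (+ℂ-congʳ (*ℂ-comm q t)) (q≈0⇒qt+u≈0 t≈0 u≈0)

      remainder-root : ∀ {q t u v} → v ≈ℂ q *ℂ t +ℂ u → q ≈ℂ 0ℂ → v ≈ℂ 0ℂ → u ≈ℂ 0ℂ
      remainder-root {q} {t} {u} {v} eq q≈0 v≈0 =
        transℂ (solve 2 (λ t u → u := # 0 :* t :+ u) reflℂ t u)
          (transℂ (+ℂ-congʳ (*ℂ-congʳ (symℂ q≈0))) (transℂ (symℂ eq) v≈0))

  module _ where
    open IntegerCoefficients commutativeRing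

    opaque
      re-coeff : ∀ p k → re (ℂ[x].coeff (toℂ[x] p) k) ≈ coeff p k
      re-coeff []      k       = refl
      re-coeff (c ∷ p) zero    = refl
      re-coeff (c ∷ p) (suc k) = re-coeff p k

    module _ {P : Carrier → Set} (cone : Cone P) where
      open Cone cone

      opaque
        AllCoeffs-quotient₁ : ∀ {α c p} → 0# ≤ α → remainder₁ α c p ≈ 0# →
                              AllCoeffs P (quotient₁ α p) → AllCoeffs P (c ∷ p)
        AllCoeffs-quotient₁ {α} {c} {p} 0≤α rem≈0 q∈P with coeff-quotient₁ α c p
        ... | c≈ , p≈ = λ
          { zero    → resp (sym (trans c≈ (trans (+-congʳ rem≈0) (+-identityˡ _)))) (*-∈ 0≤α (q∈P 0))
          ; (suc k) → resp (sym (p≈ k)) (+-∈ (q∈P k) (*-∈ 0≤α (q∈P (suc k)))) }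

        AllCoeffs-quotient₂ : ∀ {β γ c d p} → 0# ≤ β → 0# ≤ γ → r β γ c d p ≈ 0# → s β γ c d p ≈ 0# →
                              AllCoeffs P (quotient₂ β γ d p) → AllCoeffs P (c ∷ d ∷ p)
        AllCoeffs-quotient₂ {β} {γ} {c} {d} {p} 0≤β 0≤γ r≈0 s≈0 q∈P with coeff-quotient₂ β γ c d p
        ... | c≈ , d≈ , p≈ = λ
          { zero          → resp (sym (trans c≈ (trans (+-congʳ s≈0) (+-identityˡ _)))) (*-∈ 0≤γ (q∈P 0))
          ; (suc zero)    → resp (sym (trans d≈ (trans (+-congʳ r≈0) (+-identityˡ _))))
                              (+-∈ (*-∈ 0≤β (q∈P 0)) (*-∈ 0≤γ (q∈P 1)))
          ; (suc (suc k)) → resp (sym (p≈ k))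
                              (+-∈ (q∈P k) (+-∈ (*-∈ 0≤β (q∈P (suc k))) (*-∈ 0≤γ (q∈P (suc (suc k)))))) }

    NonVanishing : Poly → Set
    NonVanishing p = ∀ z → 0# < re z → ⟦ p ⟧ z ≉ℂ 0ℂ

    Signed : Poly → Set
    Signed p = AllCoeffs (0# ≤_) p ⊎ AllCoeffs (_≤ 0#) p

    opaque
      real-root : ∀ {z} → im z ≈ 0# → z +ℂ fromReal (- re z) ≈ℂ 0ℂ
      real-root im≈0 = -‿inverseʳ _ , trans (+-identityʳ _) im≈0

      complex-root : ∀ z → z *ℂ z +ℂ fromReal (- re z - re z) *ℂ z +ℂ fromReal (N z) ≈ℂ 0ℂ
      complex-root (x +i y) =
        solve 2 (λ x y → (x :* x :- y :* y) :+ ((:- x :- x) :* x :- # 0 :* y) :+ (x :* x :+ y :* y) := # 0) refl x y ,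
        solve 2 (λ x y → (x :* y :+ y :* x) :+ ((:- x :- x) :* y :+ # 0 :* x) :+ # 0 := # 0) refl x y

      -- The imaginary part ρ · im z vanishes, hence ρ = 0 and then σ = 0. Applied to the remainder
      -- left by the real quadratic of a non-real root.
      linear≈0 : ∀ {ρ σ z} → im z ≉ 0# → fromReal ρ *ℂ z +ℂ fromReal σ ≈ℂ 0ℂ → ρ ≈ 0# × σ ≈ 0#
      linear≈0 {ρ} {σ} {x +i y} y≉0 (re≈0 , im≈0) = ρ≈0 ,
        trans (solve 3 (λ σ x y → σ := # 0 :* x :- # 0 :* y :+ σ) refl σ x y)
          (trans (+-congʳ (+-congʳ (*-congʳ (sym ρ≈0)))) re≈0)
        where
        ρ≈0 : ρ ≈ 0#
        ρ≈0 = [ id , (λ y≈0 → contradiction y≈0 y≉0) ]′ (x*y≈0⇒x≈0⊎y≈0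
          (trans (solve 3 (λ ρ x y → ρ :* y := ρ :* y :+ # 0 :* x :+ # 0) refl ρ x y) im≈0))

      constant-signed : ∀ c p → (∀ k → coeff p k ≈ 0#) → Signed (c ∷ p)
      constant-signed c p p≈0 with ≤-total 0# c
      ... | inj₁ 0≤c = inj₁ λ { zero → 0≤c ; (suc k) → inj₂ (sym (p≈0 k)) }
      ... | inj₂ c≤0 = inj₂ λ { zero → c≤0 ; (suc k) → inj₂ (p≈0 k) }

    opaque
      -- Induction on the degree, splitting off X - x for a real root x ≤ 0 and
      -- X² - 2xX + |z|² for a non-real root z = x + iy.
      nonVanishing⇒signed : ∀ n p → length p ℕ.≤ n → NonVanishing p → Signed p
      nonVanishing⇒signed n [] _ _ = inj₁ (λ _ → ≤-refl)
      -- A zero tail leaves the constant c, which may have no root to split off; otherwise a root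
      -- exists.
      nonVanishing⇒signed (suc n) (c ∷ p) (ℕ.s≤s len) p≉0 with lem (Nonzero (toℂ[x] p))
      ... | no p≈0 = constant-signed c p
        (λ k → trans (sym (re-coeff p k)) (proj₁ (¬Nonzero⇒≈0 (toℂ[x] p) p≈0 k)))
      ... | yes nz with hasRoot (fromReal c) (toℂ[x] p) nz
      ...   | z , root with <-≤-connex 0# (re z) | im z ≟ 0#
      ...     | inj₁ 0<re | _ = contradiction root (p≉0 z 0<re)
      ...     | inj₂ re≤0 | yes im≈0 = conclude
        (nonVanishing⇒signed n (quotient₁ α p) (≡.subst (ℕ._≤ n) (≡.sym (length-quotient₁ α p)) len)
          (λ w 0<w q≈0 → p≉0 w 0<w (transℂ (eval-quotient₁ α c p w) (t≈0⇒qt+u≈0 q≈0 (rem≈0 , refl)))))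
        where
        α : Carrier
        α = - re z
        rem≈0 : remainder₁ α c p ≈ 0#
        rem≈0 = proj₁ (remainder-root (eval-quotient₁ α c p z) (real-root {z} im≈0) root)
        conclude : Signed (quotient₁ α p) → Signed (c ∷ p)
        conclude (inj₁ 0≤q) = inj₁ (AllCoeffs-quotient₁ nonNeg-cone (x≤0⇒0≤-x re≤0) rem≈0 0≤q)
        conclude (inj₂ q≤0) = inj₂ (AllCoeffs-quotient₁ nonPos-cone (x≤0⇒0≤-x re≤0) rem≈0 q≤0)
      nonVanishing⇒signed (suc n) (c ∷ []) _ p≉0 | yes (_ , 0≉0) | _ | inj₂ _ | no _ = contradiction reflℂ 0≉0
      nonVanishing⇒signed (suc n) (c ∷ d ∷ p) (ℕ.s≤s len) p≉0 | yes _ | z , root | inj₂ re≤0 | no im≉0 = conclude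
        (nonVanishing⇒signed n (quotient₂ β γ d p)
          -- The quadratic factor shortens the list by two, which the induction allows because n is
          -- only an upper bound for the length.
          (≡.subst (ℕ._≤ n) (≡.sym (length-quotient₂ β γ d p)) (ℕ.≤-trans (ℕ.n≤1+n _) len))
          (λ w 0<w q≈0 → p≉0 w 0<w (transℂ (eval-quotient₂ β γ c d p w) (t≈0⇒qt+u≈0 q≈0
            (transℂ (+ℂ-cong (*ℂ-congʳ (proj₁ rs≈0 , refl)) (proj₂ rs≈0 , refl)) (q≈0⇒qt+u≈0 reflℂ reflℂ))))))
        where
        β γ : Carrier
        β = - re z - re z
        γ = N z
        0≤β : 0# ≤ β
        0≤β = +-nonNeg (x≤0⇒0≤-x re≤0) (x≤0⇒0≤-x re≤0)
        rs≈0 : r β γ c d p ≈ 0# × s β γ c d p ≈ 0#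
        rs≈0 = linear≈0 {z = z} im≉0 (remainder-root (eval-quotient₂ β γ c d p z) (complex-root z) root)
        conclude : Signed (quotient₂ β γ d p) → Signed (c ∷ d ∷ p)
        conclude (inj₁ 0≤q) = inj₁ (AllCoeffs-quotient₂ nonNeg-cone 0≤β (N-nonNeg z) (proj₁ rs≈0) (proj₂ rs≈0) 0≤q)
        conclude (inj₂ q≤0) = inj₂ (AllCoeffs-quotient₂ nonPos-cone 0≤β (N-nonNeg z) (proj₁ rs≈0) (proj₂ rs≈0) q≤0)

-- The correspondence between the zeros of f and g

module Evaluation (ℝ : CompleteOrderedField) where
  open CompleteOrderedField ℝ
  open OrderedField ℝ
  open Complex ℝ
  open ComplexNumbers ℝ
  open Directions ℝ
  open RealPolynomials ℝ
  open Stability ℝ using (module ℝ[x])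
  open ℝ[x] using (Poly; _⊞_; _⊠_; const; X; coeff)
  open RawRing ℝ[x].polyRawRing using (rawSemiring)
  open Algebra.Definitions.RawSemiring rawSemiring using (_^_; sum)
  open Algebra.Properties.Semiring.Sum ℂ-semiring public
    using () renaming (sum to sumℂ; sum-cong-≋ to sumℂ-cong; *-distribˡ-sum to *ℂ-distribˡ-sum)
  open IntegerCoefficients ℂ-commutativeRing

  opaque
    eval-⊞ : ∀ p q z → ⟦ p ⊞ q ⟧ z ≈ℂ ⟦ p ⟧ z +ℂ ⟦ q ⟧ z
    eval-⊞ []      q       z = symℂ (+ℂ-identityˡ _)
    eval-⊞ (a ∷ p) []      z = symℂ (+ℂ-identityʳ _)
    eval-⊞ (a ∷ p) (b ∷ q) z = transℂ (+ℂ-cong (fromReal-+ a b) (*ℂ-congˡ (eval-⊞ p q z)))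
      (solve 5 (λ a b z p q → a :+ b :+ z :* (p :+ q) := a :+ z :* p :+ (b :+ z :* q)) reflℂ
        (fromReal a) (fromReal b) z (⟦ p ⟧ z) (⟦ q ⟧ z))

    eval-scale : ∀ a p z → ⟦ map (a *_) p ⟧ z ≈ℂ fromReal a *ℂ ⟦ p ⟧ z
    eval-scale a []      z = symℂ (zeroℂʳ _)
    eval-scale a (b ∷ p) z = transℂ (+ℂ-cong (fromReal-* a b) (*ℂ-congˡ (eval-scale a p z)))
      (solve 4 (λ a b z p → a :* b :+ z :* (a :* p) := a :* (b :+ z :* p)) reflℂ (fromReal a) (fromReal b) z (⟦ p ⟧ z))

    eval-⊠ : ∀ p q z → ⟦ p ⊠ q ⟧ z ≈ℂ ⟦ p ⟧ z *ℂ ⟦ q ⟧ z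
    eval-⊠ []      q z = symℂ (zeroℂˡ _)
    eval-⊠ (a ∷ p) q z = transℂ (eval-⊞ (map (a *_) q) (0# ∷ p ⊠ q) z)
      (transℂ (+ℂ-cong (eval-scale a q z) (+ℂ-congˡ (*ℂ-congˡ (eval-⊠ p q z))))
        (solve 4 (λ a z p q → a :* q :+ (# 0 :+ z :* (p :* q)) := (a :+ z :* p) :* q) reflℂ
          (fromReal a) z (⟦ p ⟧ z) (⟦ q ⟧ z)))

    eval-const : ∀ a z → ⟦ const a ⟧ z ≈ℂ fromReal a
    eval-const a z = solve 2 (λ a z → a :+ z :* # 0 := a) reflℂ (fromReal a) z

    eval-X : ∀ z → ⟦ X ⟧ z ≈ℂ z
    eval-X = solve 1 (λ z → # 0 :+ z :* (# 1 :+ z :* # 0) := z) reflℂ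

    eval-^ : ∀ p n z → ⟦ p ^ n ⟧ z ≈ℂ ⟦ p ⟧ z ^ℂ n
    eval-^ p zero    z = eval-const 1# z
    eval-^ p (suc n) z = transℂ (eval-⊠ p (p ^ n) z) (*ℂ-congˡ (eval-^ p n z))

    eval-X^ : ∀ n z → ⟦ X ^ n ⟧ z ≈ℂ z ^ℂ n
    eval-X^ n z = transℂ (eval-^ X n z) (^ℂ-congˡ n (eval-X z))

    eval-sum : ∀ {n} (t : Vector Poly n) z → ⟦ sum t ⟧ z ≈ℂ sumℂ (λ k → ⟦ t k ⟧ z)
    eval-sum {zero}  t z = reflℂ
    eval-sum {suc n} t z = transℂ (eval-⊞ (t Fin.zero) (sum (tail t)) z) (+ℂ-congˡ (eval-sum (tail t) z))

  opaque
    coeff-⊞ : ∀ p q k → coeff (p ⊞ q) k ≈ coeff p k + coeff q k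
    coeff-⊞ []      q       k       = sym (+-identityˡ _)
    coeff-⊞ (a ∷ p) []      k       = sym (+-identityʳ _)
    coeff-⊞ (a ∷ p) (b ∷ q) zero    = refl
    coeff-⊞ (a ∷ p) (b ∷ q) (suc k) = coeff-⊞ p q k

  module _ {P : Carrier → Set} (cone : Cone P) where
    open Cone cone

    opaque
      ⊞-closed : ∀ p q → AllCoeffs P p → AllCoeffs P q → AllCoeffs P (p ⊞ q)
      ⊞-closed p q p∈P q∈P k = resp (sym (coeff-⊞ p q k)) (+-∈ (p∈P k) (q∈P k))

      map-closed : ∀ {B : Carrier → Set} (f : Carrier → Carrier) q → (∀ {x} → B x → P (f x)) →
                   AllCoeffs B q → AllCoeffs P (map f q)
      map-closed f []      _   _   k       = 0∈
      map-closed f (b ∷ q) B⇒P q∈B zero    = B⇒P (q∈B 0)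
      map-closed f (b ∷ q) B⇒P q∈B (suc k) = map-closed f q B⇒P (λ k → q∈B (suc k)) k

      -- The two factors may satisfy different conditions: below, powers with non-negative
      -- coefficients multiply non-positive ones.
      ⊠-closed : ∀ {A B : Carrier → Set} → (∀ {x y} → A x → B y → P (x * y)) →
                 ∀ p q → AllCoeffs A p → AllCoeffs B q → AllCoeffs P (p ⊠ q)
      ⊠-closed A*B⇒P []      q _   _   k = 0∈
      ⊠-closed A*B⇒P (a ∷ p) q p∈A q∈B =
        ⊞-closed (map (a *_) q) (0# ∷ p ⊠ q) (map-closed (a *_) q (A*B⇒P (p∈A 0)) q∈B)
          λ { zero → 0∈ ; (suc k) → ⊠-closed A*B⇒P p q (λ k → p∈A (suc k)) q∈B k }

      const-closed : ∀ {a} → P a → AllCoeffs P (const a)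
      const-closed a∈P zero    = a∈P
      const-closed a∈P (suc k) = 0∈

      sum-closed : ∀ {n} (t : Vector Poly n) → (∀ k → AllCoeffs P (t k)) → AllCoeffs P (sum t)
      sum-closed {zero}  t _   k = 0∈
      sum-closed {suc n} t t∈P =
        ⊞-closed (t Fin.zero) (sum (tail t)) (t∈P Fin.zero) (sum-closed (tail t) (λ k → t∈P (Fin.suc k)))

      *-∈ʳ : ∀ {x a} → P x → 0# ≤ a → P (x * a)
      *-∈ʳ x∈P 0≤a = resp (*-comm _ _) (*-∈ 0≤a x∈P)

  opaque
    ^-nonNeg : ∀ p n → AllCoeffs (0# ≤_) p → AllCoeffs (0# ≤_) (p ^ n)
    ^-nonNeg p zero    0≤p = const-closed nonNeg-cone 0≤1
    ^-nonNeg p (suc n) 0≤p = ⊠-closed nonNeg-cone *-nonNeg p (p ^ n) 0≤p (^-nonNeg p n 0≤p)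

    X-nonNeg : AllCoeffs (0# ≤_) X
    X-nonNeg zero          = ≤-refl
    X-nonNeg (suc zero)    = 0≤1
    X-nonNeg (suc (suc k)) = ≤-refl

-- Transfer of stability along z = x / (1 + x²), and the signs of the coefficients of g

module Transfer (ℝ : CompleteOrderedField) where
  open CompleteOrderedField ℝ
  open OrderedField ℝ
  open Complex ℝ
  open ComplexNumbers ℝ
  open ComplexPolynomials ℝ
  open Directions ℝ
  open Minimum ℝ using (R≤x²)
  open FundamentalTheorem ℝ
  open RealPolynomials ℝ
  open Evaluation ℝ
  open Stability ℝ
  open ℝ[x] using (Poly; const; X)
  open RawRing ℝ[x].polyRawRing using (rawSemiring) renaming (_+_ to _+ₚ_; _*_ to _*ₚ_; 1# to 1ₚ)
  open Algebra.Definitions.RawSemiring rawSemiring using (sum) renaming (_^_ to _^ₚ_)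

  γ-term : ∀ n → Vector Carrier (suc n) → Fin (suc n) → Poly
  γ-term n g k = const (g k) *ₚ X ^ₚ toℕ k *ₚ (1ₚ +ₚ X ^ₚ 2) ^ₚ (n ∸ toℕ k)

  -- The denominator of z = x / (1 + x²). The relation is always stated as `z *ℂ w x ≈ℂ x`, free of
  -- division.
  w : ℂ → ℂ
  w x = 1ℂ +ℂ x ^ℂ 2

  module _ where
    open IntegerCoefficients commutativeRing

    opaque
      -- x̄(1 + x²) = x̄ + |x|² x, and both x̄ and x have real part `re x`.
      re-z̄x̄zw : ∀ z x → re ((conj z *ℂ conj x) *ℂ (z *ℂ w x)) ≈ N z * ((1# + N x) * re x)
      re-z̄x̄zw (a +i b) (x +i y) = solve 4 (λ a b x y →
        let w₁ = # 1 :+ (x :* (x :* # 1 :- y :* # 0) :- y :* (x :* # 0 :+ y :* # 1))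
            w₂ = # 0 :+ (x :* (x :* # 0 :+ y :* # 1) :+ y :* (x :* # 1 :- y :* # 0))
            c₁ = a :* x :- (:- b) :* (:- y)
            c₂ = a :* (:- y) :+ (:- b) :* x
        in c₁ :* (a :* w₁ :- b :* w₂) :- c₂ :* (a :* w₂ :+ b :* w₁)
           := (a :* a :+ b :* b) :* ((# 1 :+ (x :* x :+ y :* y)) :* x)) refl a b x y

      re-z̄x̄x : ∀ z x → re ((conj z *ℂ conj x) *ℂ x) ≈ N x * re z
      re-z̄x̄x (a +i b) (x +i y) = solve 4 (λ a b x y →
        (a :* x :- (:- b) :* (:- y)) :* x :- (a :* (:- y) :+ (:- b) :* x) :* y
        := (x :* x :+ y :* y) :* a) refl a b x y

      -- The real part of 1 / z = x + 1 / x, cleared of denominators.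
      re-relation : ∀ {z x} → z *ℂ w x ≈ℂ x → N z * ((1# + N x) * re x) ≈ N x * re z
      re-relation {z} {x} eq =
        trans (sym (re-z̄x̄zw z x)) (trans (proj₁ (*ℂ-congˡ {conj z *ℂ conj x} eq)) (re-z̄x̄x z x))

      0<re⇒≉0 : ∀ {z} → 0# < re z → z ≉ℂ 0ℂ
      0<re⇒≉0 0<re (re≈0 , _) = <⇒≉ 0<re re≈0

      0<1+N : ∀ x → 0# < 1# + N x
      0<1+N x = +-pos-nonNeg 0<1 (N-nonNeg x)

  module _ where
    open IntegerCoefficients ℂ-commutativeRing

    opaque
      -- By `re-z̄x̄zw` at z = 1, the product x̄(1 + x²) has positive real part.
      w≉0 : ∀ {x} → 0# < re x → w x ≉ℂ 0ℂ
      w≉0 {x} 0<re w≈0 = <⇒≉ (*-pos (N-pos {1ℂ} (0<re⇒≉0 0<1)) (*-pos (0<1+N x) 0<re))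
        (trans (sym (re-z̄x̄zw 1ℂ x)) (proj₁ (transℂ (*ℂ-congˡ {conj 1ℂ *ℂ conj x} (*ℂ-congˡ w≈0))
          (solve 1 (λ c → c :* (# 1 :* # 0) := # 0) reflℂ (conj 1ℂ *ℂ conj x)))))

      ^≉0 : ∀ {z} n → z ≉ℂ 0ℂ → z ^ℂ n ≉ℂ 0ℂ
      ^≉0 zero    z≉0 = 0<re⇒≉0 0<1
      ^≉0 (suc n) z≉0 = z*w≉0 z≉0 (^≉0 n z≉0)

      x↦z : ∀ x → 0# < re x → ∃[ z ] 0# < re z × z *ℂ w x ≈ℂ x
      x↦z x 0<re with recipℂ (w≉0 0<re)
      ... | r , wr≈1 = x *ℂ r , 0<re-z , eq
        where
        eq : (x *ℂ r) *ℂ w x ≈ℂ x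
        eq = transℂ (solve 3 (λ x r w → x :* r :* w := x :* (w :* r)) reflℂ x r (w x))
                    (transℂ (*ℂ-congˡ wr≈1) (*ℂ-identityʳ x))
        z≉0 : x *ℂ r ≉ℂ 0ℂ
        z≉0 z≈0 = 0<re⇒≉0 0<re (transℂ (symℂ eq) (transℂ (*ℂ-congʳ z≈0) (zeroℂˡ _)))
        0<re-z : 0# < re (x *ℂ r)
        0<re-z = *-cancel-pos (N-nonNeg x) (<-respʳ (re-relation eq) (*-pos (N-pos z≉0) (*-pos (0<1+N x) 0<re)))

      -- x is a root of zX² - X + z.
      z↦x : ∀ z → 0# < re z → ∃[ x ] 0# < re x × z *ℂ w x ≈ℂ x
      z↦x z 0<re with hasRoot z (-ℂ 1ℂ ∷ z ∷ []) (1 , 0<re⇒≉0 0<re)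
      -- Either root serves: their product is 1, and `re-relation` fixes the sign of the real part
      -- whichever root is found.
      ... | x , root = x ,
        *-cancel-pos (<⇒≤ (0<1+N x)) (*-cancel-pos (N-nonNeg z)
          (<-respʳ (sym (re-relation eq)) (*-pos (N-pos x≉0) 0<re))) ,
        eq
        where
        eq : z *ℂ w x ≈ℂ x
        eq = transℂ (solve 2 (λ z x → z :* (# 1 :+ x :* (x :* # 1))
                                    := z :+ x :* ((:- # 1) :+ x :* (z :+ x :* # 0)) :+ x) reflℂ z x)
                    (transℂ (+ℂ-congʳ root) (+ℂ-identityˡ x))
        x≉0 : x ≉ℂ 0ℂ
        x≉0 x≈0 = 0<re⇒≉0 0<re (transℂ
          (solve 2 (λ z x → z := z :+ x :* ((:- # 1) :+ x :* (z :+ x :* # 0)) :+ x :* (# 1 :- x :* z)) reflℂ z x)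
          (transℂ (+ℂ-cong root (*ℂ-congʳ x≈0)) (solve 1 (λ u → # 0 :+ # 0 :* u := # 0) reflℂ _)))

      eval-tabulate : ∀ {n} (g : Vector Carrier n) z → ⟦ tabulate g ⟧ z ≈ℂ sumℂ (λ k → fromReal (g k) *ℂ z ^ℂ toℕ k)
      eval-tabulate {zero}  g z = reflℂ
      eval-tabulate {suc n} g z = +ℂ-cong (symℂ (*ℂ-identityʳ _))
        (transℂ (*ℂ-congˡ (eval-tabulate (tail g) z))
          (transℂ (*ℂ-distribˡ-sum z (λ k → fromReal (tail g k) *ℂ z ^ℂ toℕ k))
            (sumℂ-cong (λ k → solve 3 (λ z a p → z :* (a :* p) := a :* (z :* p)) reflℂ z (fromReal (tail g k)) (z ^ℂ toℕ k)))))

      -- `tabulate g` has the `g k` literally as its coefficients, from which the sign argument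
      -- reads them off; the sum of products is compared with it only through values.
      eval-∑gₖxᵏ : ∀ n (g : Vector Carrier (suc n)) z → ⟦ ∑gₖxᵏ n g ⟧ z ≈ℂ ⟦ tabulate g ⟧ z
      eval-∑gₖxᵏ n g z = transℂ (eval-sum (λ k → const (g k) *ₚ X ^ₚ toℕ k) z)
        (transℂ (sumℂ-cong (λ k → transℂ (eval-⊠ (const (g k)) (X ^ₚ toℕ k) z)
                                         (*ℂ-cong (eval-const (g k) z) (eval-X^ (toℕ k) z))))
                (symℂ (eval-tabulate g z)))

      -- With x = z w, the term gₖ xᵏ wⁿ⁻ᵏ becomes wⁿ gₖ zᵏ, and wⁿ leaves the sum.
      eval-γ-form : ∀ ν n (g : Vector Carrier (suc n)) {z x} → z *ℂ w x ≈ℂ x →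
        ⟦ γ-form ν n g ⟧ x ≈ℂ ((1ℂ +ℂ x) ^ℂ toℕ ν *ℂ w x ^ℂ n) *ℂ ⟦ ∑gₖxᵏ n g ⟧ z
      eval-γ-form ν n g {z} {x} zw≈x = transℂ (eval-⊠ ((1ₚ +ₚ X) ^ₚ toℕ ν) (sum (γ-term n g)) x)
        (transℂ (*ℂ-cong prefactor sum-eq) (symℂ (*ℂ-assoc _ _ _)))
        where
        prefactor : ⟦ (1ₚ +ₚ X) ^ₚ toℕ ν ⟧ x ≈ℂ (1ℂ +ℂ x) ^ℂ toℕ ν
        prefactor = transℂ (eval-^ (1ₚ +ₚ X) (toℕ ν) x) (^ℂ-congˡ (toℕ ν)
          (transℂ (eval-⊞ 1ₚ X x) (+ℂ-cong (eval-const 1# x) (eval-X x))))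

        eval-1+X² : ⟦ 1ₚ +ₚ X ^ₚ 2 ⟧ x ≈ℂ w x
        eval-1+X² = transℂ (eval-⊞ 1ₚ (X ^ₚ 2) x) (+ℂ-cong (eval-const 1# x) (eval-X^ 2 x))

        wᵏwⁿ⁻ᵏ : ∀ (k : Fin (suc n)) → w x ^ℂ toℕ k *ℂ w x ^ℂ (n ∸ toℕ k) ≈ℂ w x ^ℂ n
        wᵏwⁿ⁻ᵏ k = ≡.subst (λ m → w x ^ℂ toℕ k *ℂ w x ^ℂ (n ∸ toℕ k) ≈ℂ w x ^ℂ m)
          (ℕ.m+[n∸m]≡n (Fin.toℕ≤pred[n] k)) (symℂ (^ℂ-homo-* (w x) (toℕ k) (n ∸ toℕ k)))

        eval-term : ∀ k → ⟦ γ-term n g k ⟧ x ≈ℂ w x ^ℂ n *ℂ (fromReal (g k) *ℂ z ^ℂ toℕ k)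
        eval-term k =
          transℂ (eval-⊠ (const (g k) *ₚ X ^ₚ toℕ k) ((1ₚ +ₚ X ^ₚ 2) ^ₚ (n ∸ toℕ k)) x)
          (transℂ (*ℂ-cong
            (transℂ (eval-⊠ (const (g k)) (X ^ₚ toℕ k) x) (*ℂ-cong (eval-const (g k) x)
              (transℂ (eval-X^ (toℕ k) x)
                (transℂ (^ℂ-congˡ (toℕ k) (symℂ zw≈x)) (^ℂ-distrib-* z (w x) (toℕ k))))))
            (transℂ (eval-^ (1ₚ +ₚ X ^ₚ 2) (n ∸ toℕ k) x) (^ℂ-congˡ (n ∸ toℕ k) eval-1+X²)))
          (transℂ (solve 4 (λ a b c d → a :* (b :* c) :* d := (c :* d) :* (a :* b)) reflℂ
                    (fromReal (g k)) (z ^ℂ toℕ k) (w x ^ℂ toℕ k) (w x ^ℂ (n ∸ toℕ k)))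
            (*ℂ-congʳ (wᵏwⁿ⁻ᵏ k))))

        sum-eq : ⟦ sum (γ-term n g) ⟧ x ≈ℂ w x ^ℂ n *ℂ ⟦ ∑gₖxᵏ n g ⟧ z
        sum-eq = transℂ (eval-sum (γ-term n g) x) (transℂ (sumℂ-cong eval-term)
          (transℂ (symℂ (*ℂ-distribˡ-sum (w x ^ℂ n) (λ k → fromReal (g k) *ℂ z ^ℂ toℕ k)))
            (*ℂ-congˡ (transℂ (symℂ (eval-tabulate g z)) (symℂ (eval-∑gₖxᵏ n g z))))))

  Vanishing : Poly → Set
  Vanishing p = ∀ z → 0# < re z → ⟦ p ⟧ z ≈ℂ 0ℂ

  opaque
    -- A non-zero polynomial is bounded away from 0 far out, in particular at the real point R ≥ 1,
    -- which lies in the half-plane.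
    vanishing⇒≋[] : ∀ p → Vanishing p → ∀ k → ℂ[x].coeff (toℂ[x] p) k ≈ℂ 0ℂ
    vanishing⇒≋[] p p≈0 k = decidable-stable (ℂ[x].coeff (toℂ[x] p) k ≟ℂ 0ℂ) λ pₖ≉0 →
      let c , R , 0<c , 1≤R , p≥c = ev-boundedBelow (toℂ[x] p) (k , pₖ≉0)
      in ≤⇒≯ (p≥c (fromReal R) (≤-respʳ (sym (N-fromReal R)) (R≤x² 1≤R (inj₁ ≤-refl))))
             (<-respˡ (sym (trans (N-cong (p≈0 (fromReal R) (<-≤-trans 0<1 1≤R))) N0≈0)) 0<c)

    hurwitzStable⇒ : ∀ p → HurwitzStable (toℂ[x] p) → Vanishing p ⊎ NonVanishing p
    hurwitzStable⇒ p (inj₁ p≋[]) = inj₁ λ z _ → ev-≈0 (toℂ[x] p) p≋[] z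
    hurwitzStable⇒ p (inj₂ p≉0)  = inj₂ p≉0

    ⇒hurwitzStable : ∀ p → Vanishing p ⊎ NonVanishing p → HurwitzStable (toℂ[x] p)
    ⇒hurwitzStable p (inj₁ p≈0) = inj₁ (vanishing⇒≋[] p p≈0)
    ⇒hurwitzStable p (inj₂ p≉0) = inj₂ p≉0

  module _ (ν : Fin 2) (n : ℕ) (g : Vector Carrier (suc n)) where
    f G : Poly
    f = γ-form ν n g
    G = ∑gₖxᵏ n g

    opaque
      prefactor≉0 : ∀ {x} → 0# < re x → (1ℂ +ℂ x) ^ℂ toℕ ν *ℂ w x ^ℂ n ≉ℂ 0ℂ
      prefactor≉0 0<re = z*w≉0 (^≉0 (toℕ ν) (0<re⇒≉0 (+-pos-nonNeg 0<1 (<⇒≤ 0<re)))) (^≉0 n (w≉0 0<re))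

      f≈0⇒G≈0 : ∀ {z x} → 0# < re x → z *ℂ w x ≈ℂ x → ⟦ f ⟧ x ≈ℂ 0ℂ → ⟦ G ⟧ z ≈ℂ 0ℂ
      f≈0⇒G≈0 {z} 0<re eq f≈0 = decidable-stable (⟦ G ⟧ z ≟ℂ 0ℂ) λ G≉0 →
        z*w≉0 (prefactor≉0 0<re) G≉0 (transℂ (symℂ (eval-γ-form ν n g eq)) f≈0)

      G≈0⇒f≈0 : ∀ {z x} → z *ℂ w x ≈ℂ x → ⟦ G ⟧ z ≈ℂ 0ℂ → ⟦ f ⟧ x ≈ℂ 0ℂ
      G≈0⇒f≈0 eq G≈0 = transℂ (eval-γ-form ν n g eq) (transℂ (*ℂ-congˡ G≈0) (zeroℂʳ _))

      NonVanishing-f⇒G : NonVanishing f → NonVanishing G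
      NonVanishing-f⇒G f≉0 z 0<z G≈0 = let x , 0<x , eq = z↦x z 0<z in f≉0 x 0<x (G≈0⇒f≈0 eq G≈0)

      f⇒G : Vanishing f ⊎ NonVanishing f → Vanishing G ⊎ NonVanishing G
      f⇒G (inj₁ f≈0) = inj₁ λ z 0<z → let x , 0<x , eq = z↦x z 0<z in f≈0⇒G≈0 0<x eq (f≈0 x 0<x)
      f⇒G (inj₂ f≉0) = inj₂ (NonVanishing-f⇒G f≉0)

      G⇒f : Vanishing G ⊎ NonVanishing G → Vanishing f ⊎ NonVanishing f
      G⇒f (inj₁ G≈0) = inj₁ λ x 0<x → let z , 0<z , eq = x↦z x 0<x in G≈0⇒f≈0 eq (G≈0 z 0<z)
      G⇒f (inj₂ G≉0) = inj₂ λ x 0<x f≈0 → let z , 0<z , eq = x↦z x 0<x in G≉0 z 0<z (f≈0⇒G≈0 0<x eq f≈0)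

    coeff-tabulate : ∀ {m} (h : Vector Carrier m) k → ℝ[x].coeff (tabulate h) (toℕ k) ≡ h k
    coeff-tabulate h Fin.zero    = ≡.refl
    coeff-tabulate h (Fin.suc k) = coeff-tabulate (tail h) k

    opaque
      -- All other factors, the powers of 1 + X, X and 1 + X², have non-negative coefficients. This
      -- rules out the negative sign when f has a positive coefficient.
      f-nonPos : (∀ k → g k ≤ 0#) → AllCoeffs (_≤ 0#) f
      f-nonPos g≤0 = ⊠-closed nonPos-cone (*-∈ nonPos-cone) ((1ₚ +ₚ X) ^ₚ toℕ ν) (sum (γ-term n g))
        (^-nonNeg (1ₚ +ₚ X) (toℕ ν) (1+-nonNeg X X-nonNeg))
        (sum-closed nonPos-cone (γ-term n g) λ k →
          ⊠-closed nonPos-cone (*-∈ʳ nonPos-cone) (const (g k) *ₚ X ^ₚ toℕ k) ((1ₚ +ₚ X ^ₚ 2) ^ₚ (n ∸ toℕ k))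
            (⊠-closed nonPos-cone (*-∈ʳ nonPos-cone) (const (g k)) (X ^ₚ toℕ k)
              (const-closed nonPos-cone (g≤0 k)) (^-nonNeg X (toℕ k) X-nonNeg))
            (^-nonNeg (1ₚ +ₚ X ^ₚ 2) (n ∸ toℕ k) (1+-nonNeg (X ^ₚ 2) (^-nonNeg X 2 X-nonNeg))))
        where
        open Cone using (*-∈)
        1+-nonNeg : ∀ p → AllCoeffs (0# ≤_) p → AllCoeffs (0# ≤_) (1ₚ +ₚ p)
        1+-nonNeg p = ⊞-closed nonNeg-cone 1ₚ p (const-closed nonNeg-cone 0≤1)

    opaque
      leading-pos⇒nonNeg : HurwitzStable (toℂ[x] f) → ∀ a → ℝ[x].IsLeadingCoefficient f a → 0# < a → ∀ k → 0# ≤ g k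
      leading-pos⇒nonNeg stable a (d , f_d≈a , _) 0<a k with hurwitzStable⇒ f stable
      ... | inj₁ f≈0 = contradiction
        (trans (sym f_d≈a) (trans (sym (re-coeff f d)) (proj₁ (vanishing⇒≋[] f f≈0 d)))) (<⇒≉ 0<a)
      ... | inj₂ f≉0 with nonVanishing⇒signed _ (tabulate g) ℕ.≤-refl
            (λ z 0<z g≈0 → NonVanishing-f⇒G f≉0 z 0<z (transℂ (eval-∑gₖxᵏ n g z) g≈0))
      ...   | inj₁ 0≤g = ≡.subst (0# ≤_) (coeff-tabulate g k) (0≤g (toℕ k))
      ...   | inj₂ g≤0 = contradiction (<-respʳ (sym f_d≈a) 0<a)
            (≤⇒≯ (f-nonPos (λ k → ≡.subst (_≤ 0#) (coeff-tabulate g k) (g≤0 (toℕ k))) d))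

theorem4p3 : (ℝ : CompleteOrderedField) →
    let open CompleteOrderedField ℝ
        open Stability ℝ
    in
    (ν : Fin 2) (n : ℕ) (g : Vector Carrier (suc n)) →
    let f = γ-form ν n g in
    (HurwitzStable (toℂ[x] f) ⇔ HurwitzStable (toℂ[x] (∑gₖxᵏ n g)))
    × (HurwitzStable (toℂ[x] f) →
       ∀ a → ℝ[x].IsLeadingCoefficient f a → 0# < a →
       SemiγPositive f ν n g)
theorem4p3 ℝ ν n g =
  mk⇔ (λ stable → ⇒hurwitzStable (∑gₖxᵏ n g) (f⇒G ν n g (hurwitzStable⇒ (γ-form ν n g) stable)))
      (λ stable → ⇒hurwitzStable (γ-form ν n g) (G⇒f ν n g (hurwitzStable⇒ (∑gₖxᵏ n g) stable))) ,
  λ stable a leading 0<a → record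
    { expansion   = λ _ → refl
    ; nonNegative = leading-pos⇒nonNeg ν n g stable a leading 0<a
    }
  where
  open CompleteOrderedField ℝ
  open Stability ℝ
  open Transfer ℝ
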